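{- Let $n_0\in\mathbb{N}$ and let $(T_n(x))_{n\ge n_0}$ be real polynomials satisfying, for $n\ge n_0$, $$T_{n+1}(x)=(\alpha_n x^2+\beta_n x+\gamma_n)T_n(x)+(\mu_n x^3+\varphi_n x)\,\frac{d}{dx}T_n(x),$$ where $\alpha_n,\beta_n,\gamma_n,\mu_n,\varphi_n$ are real sequences with $\beta_n,\gamma_n,\varphi_n\ge 0$ for all $n$. Assume that $T_{n_0}(x)$ is Hurwitz stable. If one of the following holds (for all $n \ge n_0$): (1) $\deg(T_n(x))=n$ and $\alpha_n=-n\mu_n\ge 0$; (2) $\deg(T_n(x))=m_n$ with $m_n\ne n$, and $\alpha_n\ge -m_n\mu_n\ge 0$; then $T_n(x)$ is Hurwitz stable for all $n\ge n_0$.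
   Context: A polynomial $f\in\mathbb{C}[x]$ is Hurwitz stable if it is identically zero or $f(x)\ne 0$ whenever $\Re(x)>0$. -}

module Defs where

open import Algebra.Bundles using (CommutativeRing; RawRing)
import Algebra.Definitions.RawMonoid as RawMonoidDefinitions
open import Data.List.Base using (List; []; _∷_; map; foldr)
open import Data.Nat.Base using (ℕ; zero; suc) renaming (_<_ to _<ℕ_)
open import Data.Product.Base using (_×_; ∃; ∃-syntax)
open import Data.Sum.Base using (_⊎_)
open import Level using (Level; _⊔_) renaming (suc to lsuc)
open import Relation.Binary.Core using (Rel)
import Relation.Binary.Construct.NonStrictToStrict as NonStrictToStrict
open import Relation.Binary.Structures using (IsDecTotalOrder)
open import Relation.Nullary.Negation.Core using (¬_)
open import Relation.Unary using (Pred)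

-- The axioms characterising the field ℝ: a Dedekind-complete totally ordered
-- field.  Classically ℝ is its only model up to isomorphism; the decidability
-- of the order records that ℝ is understood classically.
record CompleteOrderedField c ℓ₁ ℓ₂ : Set (lsuc (c ⊔ ℓ₁ ⊔ ℓ₂)) where
  infix 4 _≤_
  field
    commutativeRing : CommutativeRing c ℓ₁

  open CommutativeRing commutativeRing public

  field
    _≤_             : Rel Carrier ℓ₂
    isDecTotalOrder : IsDecTotalOrder _≈_ _≤_
    1≉0             : 1# ≉ 0#
    inverse         : ∀ x → x ≉ 0# → ∃[ y ] x * y ≈ 1#
    +-monoʳ-≤       : ∀ x {y z} → y ≤ z → x + y ≤ x + z
    *-nonNegative   : ∀ {x y} → 0# ≤ x → 0# ≤ y → 0# ≤ x * y

  IsUpperBound : ∀ {ℓ} → Pred Carrier ℓ → Carrier → Set (c ⊔ ℓ₂ ⊔ ℓ)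
  IsUpperBound P b = ∀ x → P x → x ≤ b

  field
    leastUpperBound : (P : Pred Carrier (c ⊔ ℓ₁ ⊔ ℓ₂)) → ∃ P → ∃ (IsUpperBound P) →
      ∃[ s ] IsUpperBound P s × (∀ b → IsUpperBound P b → s ≤ b)

  open NonStrictToStrict _≈_ _≤_ public using (_<_)

-- Univariate polynomials, as lists of coefficients with the constant term
-- first.  Trailing zero coefficients are allowed, so equality of polynomials
-- is _≋_ rather than equality of lists.
module Polynomial {c ℓ} (R : RawRing c ℓ) where
  open RawRing R
  open RawMonoidDefinitions +-rawMonoid public using () renaming (_×_ to _·_)

  infix  4 _≋_
  infixl 6 _⊕_
  infixl 7 _⊗_

  Poly : Set c
  Poly = List Carrier

  coeff : Poly → ℕ → Carrier
  coeff []      _       = 0#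
  coeff (a ∷ _) zero    = a
  coeff (_ ∷ p) (suc k) = coeff p k

  _≋_ : Rel Poly ℓ
  p ≋ q = ∀ k → coeff p k ≈ coeff q k

  _⊕_ : Poly → Poly → Poly
  []      ⊕ q       = q
  (a ∷ p) ⊕ []      = a ∷ p
  (a ∷ p) ⊕ (b ∷ q) = (a + b) ∷ (p ⊕ q)

  _⊗_ : Poly → Poly → Poly
  []      ⊗ _ = []
  (a ∷ p) ⊗ q = map (a *_) q ⊕ (0# ∷ (p ⊗ q))

  -- scaleFrom k [a₀, a₁, a₂, …] = [k·a₀, (k+1)·a₁, (k+2)·a₂, …]
  scaleFrom : ℕ → Poly → Poly
  scaleFrom _ []      = []
  scaleFrom k (a ∷ p) = (k · a) ∷ scaleFrom (suc k) p

  derivative : Poly → Poly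
  derivative []      = []
  derivative (_ ∷ p) = scaleFrom 1 p

  eval : Poly → Carrier → Carrier
  eval p x = foldr (λ a v → a + x * v) 0# p

  -- The zero polynomial has no degree.
  HasDegree : Poly → ℕ → Set ℓ
  HasDegree p d = coeff p d ≉ 0# × (∀ k → d <ℕ k → coeff p k ≈ 0#)

module Hurwitz {c ℓ₁ ℓ₂} (ℝ : CompleteOrderedField c ℓ₁ ℓ₂) where
  open CompleteOrderedField ℝ

  module ℝ[x] = Polynomial rawRing

  infix 5 _+i_

  record ℂ : Set c where
    constructor _+i_
    field
      re : Carrier
      im : Carrier

  open ℂ public

  ℂ-rawRing : RawRing c ℓ₁
  ℂ-rawRing = record
    { Carrier = ℂ
    ; _≈_     = λ z w → re z ≈ re w × im z ≈ im w
    ; _+_     = λ z w → (re z + re w) +i (im z + im w)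
    ; _*_     = λ z w → (re z * re w - im z * im w) +i (re z * im w + im z * re w)
    ; -_      = λ z → (- re z) +i (- im z)
    ; 0#      = 0# +i 0#
    ; 1#      = 1# +i 0#
    }

  module ℂ[x] = Polynomial ℂ-rawRing

  HurwitzStable : ℂ[x].Poly → Set (c ⊔ ℓ₁ ⊔ ℓ₂)
  HurwitzStable f =
    f ℂ[x].≋ [] ⊎ (∀ z → 0# < re z → RawRing._≉_ ℂ-rawRing (ℂ[x].eval f z) (0# +i 0#))

  toℂ[x] : ℝ[x].Poly → ℂ[x].Poly
  toℂ[x] = map (_+i 0#)

{-# OPTIONS --safe #-}

-- Let P be the monic multiple of Tₙ, of degree m.  By the fundamental theorem of
-- algebra P splits into linear factors, with all roots in the closed left
-- half-plane, so for Re z > 0 both ⟨P′, P⟩ and ⟨m z P − z² P′, P⟩ are nonnegative,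
-- where ⟨u, v⟩ = Re (u v̄); the second is the first for the reversed polynomial
-- yᵐ P(1/y) at y = 1/z.  Consequently ⟨Tₙ₊₁(z), z P(z)⟩ is, up to a nonzero real
-- factor, a sum of nonnegative terms.
-- If Tₙ₊₁(z) = 0 then all of them vanish, which by the equality cases makes Tₙ₊₁
-- the zero polynomial, contradicting that it has a degree.
--
-- The order being decidable, stability is a negative statement, so roots are only
-- needed under a double negation.  A monic f of positive degree without
-- roots admits at each z some w with |f(w)| < |f(z)| (Argand); by compactness one
-- w serves for all z in a large square, including w itself.

module Submission where

-- The signs come from a regrouping. Up to the leading coefficient, Tₙ₊₁ = z X + γ P with X = σ z P
-- + β P + φ P′ - μ (m z P - z² P′) and σ = α + mμ: the term μ z³ P′ is paired with a share -mμ z² P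
-- of α z² P, and -mμ ≤ α says precisely that σ ≥ 0. Testing against z P rather than P turns ⟨z X, z
-- P⟩ into |z|² ⟨X, P⟩ and the γ term into γ Re z |P|², so that no division by z occurs. A decidable
-- order decides equations between reals but not existential statements, so arguments by supremum
-- reach existence only under a double negation. One principle of real induction, `creeping`, yields
-- both compactness and square roots in this form. Argand's argument has neither polar coordinates
-- nor k-th roots at its disposal: for odd exponents a descent direction is found among the fourth
-- roots of unity, and even exponents are halved by taking complex square roots.

open import Defs
open import Algebra.Bundles using (CommutativeRing; RawRing)
import Algebra.Properties.Semiring.Exp as Exp
import Algebra.Properties.Monoid.Mult.TCOptimised as MultTC
import Algebra.Properties.Ring as RingProperties
import Algebra.Properties.Semiring.Mult as Mult
import Algebra.Solver.Ring as RingSolver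
open import Algebra.Solver.Ring.AlmostCommutativeRing
  using (fromCommutativeRing; -raw-almostCommutative⟶; _-Raw-AlmostCommutative⟶_)
open import Data.Empty using (⊥; ⊥-elim)
open import Data.List.Base using (List; []; _∷_; map)
open import Data.Maybe.Base using (Maybe; just; nothing)
open import Data.Nat.Base as ℕ using (ℕ; zero; suc; s≤s; z≤n) renaming (_≤_ to _≤ℕ_)
import Data.Nat.Properties as ℕ
open import Data.Product.Base using (Σ-syntax; _×_; _,_; proj₁; proj₂; ∃; ∃-syntax)
open import Data.Sum.Base using (_⊎_; inj₁; inj₂)
open import Data.Vec.Base using (Vec; []; _∷_; replicate)
open import Data.Vec.Relation.Unary.All using (All; []; _∷_)
open import Level using (_⊔_; Lift; lift)
open import Relation.Binary.PropositionalEquality.Core as ≡ using (_≡_; _≢_)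
open import Relation.Binary.Structures using (IsDecTotalOrder)
open import Relation.Nullary.Decidable.Core using (Dec; yes; no)
open import Relation.Nullary.Negation.Core using (¬_)

-- The ring solver with integer coefficients, an integer a − b being coded as
-- the pair (a , b).  Testing coefficients in ℕ lets the solver cancel terms,
-- which the undecidable zero test of an arbitrary ring would not.
module IntegerSolver {c ℓ} (R : CommutativeRing c ℓ) where
  open CommutativeRing R
  open RingProperties ring using (-0#≈0#; -‿distribˡ-*; -‿distribʳ-*; -‿involutive; -‿+-comm)
  open Mult semiring using (×-homo-+; ×1-homo-*; ×-congˡ) renaming (_×_ to _·_)
  open MultTC +-monoid using (×ᵤ≈×) renaming (_×_ to _·′_)

  private
    open RingSolver rawRing (fromCommutativeRing R)
      (-raw-almostCommutative⟶ (fromCommutativeRing R)) (λ _ _ → nothing)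
      using (solve; _:+_; _:*_; :-_; _:-_; _:=_)

    -- The separate case without subtrahend and the optimised multiple make `(0 , 0)` and `(1 , 0)`
    -- compute to `0#` and `1#`, so that `:0` and `:1` match goals literally.
    ⟦_⟧ : ℕ × ℕ → Carrier
    ⟦ a , zero  ⟧ = a ·′ 1#
    ⟦ a , suc b ⟧ = a ·′ 1# - suc b ·′ 1#

    value : ℕ × ℕ → Carrier
    value (a , b) = a · 1# - b · 1#

    ⟦⟧≈value : ∀ x → ⟦ x ⟧ ≈ value x
    ⟦⟧≈value (a , zero)  = trans (sym (×ᵤ≈× a 1#)) (sym (trans (+-congˡ -0#≈0#) (+-identityʳ _)))
    ⟦⟧≈value (a , suc b) = +-cong (sym (×ᵤ≈× a 1#)) (-‿cong (sym (×ᵤ≈× (suc b) 1#)))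

    value-cong : ∀ a b c d → a ℕ.+ d ≡ c ℕ.+ b → value (a , b) ≈ value (c , d)
    value-cong a b c d p =
      trans (sym (swap (a · 1#) b̂ d̂)) (trans (+-congʳ a+d≈c+b) (swap′ (c · 1#) b̂ d̂))
      where
      b̂ = b · 1#
      d̂ = d · 1#
      a+d≈c+b : a · 1# + d̂ ≈ c · 1# + b̂
      a+d≈c+b = trans (sym (×-homo-+ 1# a d)) (trans (×-congˡ p) (×-homo-+ 1# c b))
      swap : ∀ x y z → (x + z) + (- y + - z) ≈ x - y
      swap x y z = trans
        (solve 4 (λ x y z w → (x :+ z) :+ (y :+ w) := (x :+ y) :+ (z :+ w)) refl x (- y) z (- z))
        (trans (+-congˡ (-‿inverseʳ z)) (+-identityʳ _))
      swap′ : ∀ x y z → (x + y) + (- y + - z) ≈ x - z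
      swap′ x y z = trans (+-congˡ (+-comm (- y) (- z))) (swap x z y)

    -- A canonical representative, so that equal coefficients are identical.
    reduce : ℕ × ℕ → ℕ × ℕ
    reduce (a , b) = a ℕ.∸ b , b ℕ.∸ a

    reduce≈value : ∀ x → ⟦ reduce x ⟧ ≈ value x
    reduce≈value (a , b) = trans (⟦⟧≈value (reduce (a , b))) (value-cong (a ℕ.∸ b) (b ℕ.∸ a) a b
      (balance a b))
      where
      balance : ∀ a b → (a ℕ.∸ b) ℕ.+ b ≡ a ℕ.+ (b ℕ.∸ a)
      balance zero    b       = ≡.cong (ℕ._+ b) (ℕ.0∸n≡0 b)
      balance (suc a) zero    = ≡.refl
      balance (suc a) (suc b) = ≡.trans (ℕ.+-suc (a ℕ.∸ b) b) (≡.cong suc (balance a b))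

    coefficients : RawRing _ _
    coefficients = record
      { Carrier = ℕ × ℕ
      ; _≈_     = _≡_
      ; _+_     = λ (a , b) (c , d) → reduce (a ℕ.+ c , b ℕ.+ d)
      ; _*_     = λ (a , b) (c , d) → reduce (a ℕ.* c ℕ.+ b ℕ.* d , a ℕ.* d ℕ.+ b ℕ.* c)
      ; -_      = λ (a , b) → b , a
      ; 0#      = 0 , 0
      ; 1#      = 1 , 0
      }

    ·1-homo-dot : ∀ a b c d →
      (a ℕ.* c ℕ.+ b ℕ.* d) · 1# ≈ (a · 1#) * (c · 1#) + (b · 1#) * (d · 1#)
    ·1-homo-dot a b c d = trans (×-homo-+ 1# (a ℕ.* c) (b ℕ.* d))
      (+-cong (×1-homo-* a c) (×1-homo-* b d))

    product : ∀ a b c d → (a - b) * (c - d) ≈ (a * c + b * d) - (a * d + b * c)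
    product a b c d = trans
      (solve 4 (λ a b c d → (a :+ b) :* (c :+ d) := (a :* c :+ b :* d) :+ (a :* d :+ b :* c))
        refl a (- b) c (- d))
      (+-cong (+-congˡ (trans (sym (-‿distribˡ-* b (- d)))
                         (trans (-‿cong (sym (-‿distribʳ-* b d))) (-‿involutive (b * d)))))
        (trans (+-cong (sym (-‿distribʳ-* a d)) (sym (-‿distribˡ-* b c)))
               (-‿+-comm (a * d) (b * c))))

    morphism : coefficients -Raw-AlmostCommutative⟶ fromCommutativeRing R
    morphism = record
      { ⟦_⟧    = ⟦_⟧
      ; +-homo = λ x@(a , b) y@(c , d) → trans (reduce≈value (a ℕ.+ c , b ℕ.+ d)) (trans
          (trans (+-cong (×-homo-+ 1# a c) (-‿cong (×-homo-+ 1# b d)))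
          (trans (+-congˡ (sym (-‿+-comm (b · 1#) (d · 1#))))
          (solve 4 (λ a b c d → (a :+ c) :+ (b :+ d) := (a :+ b) :+ (c :+ d)) refl
            (a · 1#) (- (b · 1#)) (c · 1#) (- (d · 1#)))))
          (sym (+-cong (⟦⟧≈value x) (⟦⟧≈value y))))
      ; *-homo = λ x@(a , b) y@(c , d) →
          trans (reduce≈value (a ℕ.* c ℕ.+ b ℕ.* d , a ℕ.* d ℕ.+ b ℕ.* c)) (trans
          (trans (+-cong (·1-homo-dot a b c d) (-‿cong (·1-homo-dot a b d c)))
          (sym (product (a · 1#) (b · 1#) (c · 1#) (d · 1#))))
          (sym (*-cong (⟦⟧≈value x) (⟦⟧≈value y))))
      ; -‿homo = λ x@(a , b) → trans (⟦⟧≈value (b , a)) (trans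
          (trans (+-comm (b · 1#) (- (a · 1#)))
          (trans (+-congˡ (sym (-‿involutive (b · 1#)))) (-‿+-comm (a · 1#) (- (b · 1#)))))
          (-‿cong (sym (⟦⟧≈value x))))
      ; 0-homo = refl
      ; 1-homo = refl
      }

    _≟_ : ∀ x y → Maybe (⟦ x ⟧ ≈ ⟦ y ⟧)
    x@(a , b) ≟ y@(c , d) with a ℕ.+ d ℕ.≟ c ℕ.+ b
    ... | no  _ = nothing
    ... | yes p = just (trans (⟦⟧≈value x) (trans (value-cong a b c d p) (sym (⟦⟧≈value y))))

    module Solver = RingSolver coefficients (fromCommutativeRing R) morphism _≟_

  open Solver public using (solve; _:+_; _:*_; :-_; _:-_; _:=_)

  :0 :1 : ∀ {n} → Solver.Polynomial n
  :0 = Solver.con (0 , 0)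
  :1 = Solver.con (1 , 0)

-- A vector of length n stands for the monic polynomial of degree n with these
-- lower coefficients, constant term first.
module MonicPolynomial {c ℓ} (R : CommutativeRing c ℓ) where
  open CommutativeRing R
  open IntegerSolver R

  private variable n : ℕ

  eval : Vec Carrier n → Carrier → Carrier
  eval []      z = 1#
  eval (a ∷ p) z = a + z * eval p z

  evalDerivative : Vec Carrier n → Carrier → Carrier
  evalDerivative []      z = 0#
  evalDerivative (a ∷ p) z = eval p z + z * evalDerivative p z

  eval-cong : ∀ (p : Vec Carrier n) {z w} → z ≈ w → eval p z ≈ eval p w
  eval-cong []      z≈w = refl
  eval-cong (a ∷ p) z≈w = +-congˡ (*-cong z≈w (eval-cong p z≈w))

  -- Synthetic division by x - r: the coefficients are the intermediate values of Horner's scheme at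
  -- r.
  quotient : Vec Carrier (suc n) → Carrier → Vec Carrier n
  quotient (a ∷ [])        r = []
  quotient (a ∷ p@(_ ∷ _)) r = eval p r ∷ quotient p r

  eval-quotient : ∀ (p : Vec Carrier (suc n)) r z →
    eval p z ≈ eval p r + (z - r) * eval (quotient p r) z
  eval-quotient (a ∷ [])        r z =
    solve 3 (λ a r z → a :+ z :* :1 := a :+ r :* :1 :+ (z :- r) :* :1)
      refl a r z
  eval-quotient (a ∷ p@(_ ∷ _)) r z = trans
    (+-congˡ (*-congˡ (eval-quotient p r z)))
    (solve 5 (λ a r z p q → a :+ z :* (p :+ (z :- r) :* q)
                            := a :+ r :* p :+ (z :- r) :* (p :+ z :* q))
      refl a r z (eval p r) (eval (quotient p r) z))

  evalDerivative-quotient : ∀ (p : Vec Carrier (suc n)) r z →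
    evalDerivative p z ≈ eval (quotient p r) z + (z - r) * evalDerivative (quotient p r) z
  evalDerivative-quotient (a ∷ [])        r z =
    solve 2 (λ r z → :1 :+ z :* :0 := :1 :+ (z :- r) :* :0)
      refl r z
  evalDerivative-quotient (a ∷ p@(_ ∷ _)) r z = trans
    (+-cong (eval-quotient p r z) (*-congˡ (evalDerivative-quotient p r z)))
    (solve 5 (λ r z p q d → p :+ (z :- r) :* q :+ z :* (q :+ (z :- r) :* d)
                            := p :+ z :* q :+ (z :- r) :* (q :+ z :* d))
      refl r z (eval p r) (eval (quotient p r) z) (evalDerivative (quotient p r) z))

  evalRoots : Vec Carrier n → Carrier → Carrier
  evalRoots []       z = 1#
  evalRoots (r ∷ rs) z = (z - r) * evalRoots rs z

  evalRootsDerivative : Vec Carrier n → Carrier → Carrier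
  evalRootsDerivative []       z = 0#
  evalRootsDerivative (r ∷ rs) z = evalRoots rs z + (z - r) * evalRootsDerivative rs z

  module Coefficients where
    module R[x] = Polynomial rawRing

    derivativeAt : List Carrier → Carrier → Carrier
    derivativeAt []      z = 0#
    derivativeAt (a ∷ p) z = R[x].eval p z + z * derivativeAt p z

    ≋[]⇒eval≈0 : ∀ p → (∀ k → R[x].coeff p k ≈ 0#) → ∀ z → R[x].eval p z ≈ 0#
    ≋[]⇒eval≈0 []      h z = refl
    ≋[]⇒eval≈0 (a ∷ p) h z = trans
      (+-cong (h 0) (*-congˡ (≋[]⇒eval≈0 p (λ k → h (suc k)) z)))
      (trans (+-identityˡ _) (zeroʳ z))

    ≋[]⇒derivativeAt≈0 : ∀ p → (∀ k → R[x].coeff p k ≈ 0#) → ∀ z → derivativeAt p z ≈ 0#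
    ≋[]⇒derivativeAt≈0 []      h z = refl
    ≋[]⇒derivativeAt≈0 (a ∷ p) h z = trans
      (+-cong (≋[]⇒eval≈0 p (λ k → h (suc k)) z)
              (*-congˡ (≋[]⇒derivativeAt≈0 p (λ k → h (suc k)) z)))
      (trans (+-identityˡ _) (zeroʳ z))

    eval-≋ : ∀ p q → (∀ k → R[x].coeff p k ≈ R[x].coeff q k) → ∀ z → R[x].eval p z ≈ R[x].eval q z
    eval-≋ []      q       h z = sym (≋[]⇒eval≈0 q (λ k → sym (h k)) z)
    eval-≋ (a ∷ p) []      h z = ≋[]⇒eval≈0 (a ∷ p) h z
    eval-≋ (a ∷ p) (b ∷ q) h z = +-cong (h 0) (*-congˡ (eval-≋ p q (λ k → h (suc k)) z))

    -- The lower coefficients are multiplied by `u`, the inverse of the leading one, which stays the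
    -- same when the head of the list is removed. The derivative is treated in the same induction,
    -- so formal derivatives never have to be compared coefficientwise.
    normalize : ∀ p n {u} → R[x].coeff p n * u ≈ 1# → (∀ k → n ℕ.< k → R[x].coeff p k ≈ 0#) →
      ∃[ q ] ∀ z → R[x].eval p z ≈ R[x].coeff p n * eval {n} q z
                 × derivativeAt p z ≈ R[x].coeff p n * evalDerivative {n} q z
    -- The leading coefficient is `0#` here, so both sides vanish for any vector.
    normalize []      n       cu≈1 h = replicate n 0# , λ z → sym (zeroˡ _) , sym (zeroˡ _)
    normalize (a ∷ p) zero    cu≈1 h = [] , λ z →
        trans (+-congˡ (trans (*-congˡ (≋[]⇒eval≈0 p h′ z)) (zeroʳ z)))
              (trans (+-identityʳ a) (sym (*-identityʳ a)))
      , trans (+-cong (≋[]⇒eval≈0 p h′ z) (trans (*-congˡ (≋[]⇒derivativeAt≈0 p h′ z)) (zeroʳ z)))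
              (trans (+-identityʳ 0#) (sym (zeroʳ a)))
      where
      h′ : ∀ k → R[x].coeff p k ≈ 0#
      h′ k = h (suc k) (s≤s z≤n)
    normalize (a ∷ p) (suc n) {u} cu≈1 h with normalize p n cu≈1 (λ k n<k → h (suc k) (s≤s n<k))
    ... | q , eq = (u * a) ∷ q , λ z →
        trans (+-cong (sym (trans (sym (*-assoc lead u a)) (trans (*-congʳ cu≈1) (*-identityˡ a))))
                      (*-congˡ (proj₁ (eq z))))
              (solve 5 (λ c u a z q → c :* (u :* a) :+ z :* (c :* q) := c :* (u :* a :+ z :* q))
                refl lead u a z (eval q z))
      , trans (+-cong (proj₁ (eq z)) (*-congˡ (proj₂ (eq z))))
              (solve 4 (λ c z q d → c :* q :+ z :* (c :* d) := c :* (q :+ z :* d))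
                refl lead z (eval q z) (evalDerivative q z))
      where lead = R[x].coeff p n

-- Ordered-field arithmetic, real induction and absolute bounds.

module OrderedField {c ℓ₁ ℓ₂} (ℝ : CompleteOrderedField c ℓ₁ ℓ₂) where
  open CompleteOrderedField ℝ
  open IsDecTotalOrder isDecTotalOrder
    using (_≟_; total; antisym)
    renaming (reflexive to ≤-reflexive; trans to ≤-trans; ≤-respˡ-≈ to ≤-respˡ; ≤-respʳ-≈ to ≤-respʳ) public
  open IntegerSolver commutativeRing public

  ≤-refl : ∀ {x} → x ≤ x
  ≤-refl = ≤-reflexive refl

  x≤y⇒0≤y-x : ∀ {x y} → x ≤ y → 0# ≤ y - x
  x≤y⇒0≤y-x {x} {y} x≤y = ≤-respˡ (-‿inverseˡ x) (≤-respʳ (+-comm (- x) y) (+-monoʳ-≤ (- x) x≤y))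

  0≤y-x⇒x≤y : ∀ {x y} → 0# ≤ y - x → x ≤ y
  0≤y-x⇒x≤y {x} {y} 0≤y-x = ≤-respˡ (+-identityʳ x)
    (≤-respʳ (solve 2 (λ x y → x :+ (y :- x) := y) refl x y) (+-monoʳ-≤ x 0≤y-x))

  0≤x+y : ∀ {x y} → 0# ≤ x → 0# ≤ y → 0# ≤ x + y
  0≤x+y {x} {y} 0≤x 0≤y = ≤-trans 0≤x (≤-respˡ (+-identityʳ x) (+-monoʳ-≤ x 0≤y))

  0<-resp : ∀ {x y} → x ≈ y → 0# < x → 0# < y
  0<-resp x≈y (0≤x , 0≉x) = ≤-respʳ x≈y 0≤x , λ 0≈y → 0≉x (trans 0≈y (sym x≈y))

  0<x⇒0≰-x : ∀ {x} → 0# < x → ¬ (0# ≤ - x)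
  0<x⇒0≰-x {x} (0≤x , 0≉x) 0≤-x =
    0≉x (antisym 0≤x (0≤y-x⇒x≤y (≤-respʳ (sym (+-identityˡ (- x))) 0≤-x)))

  0≤-x⇒x≤0 : ∀ {x} → 0# ≤ - x → x ≤ 0#
  0≤-x⇒x≤0 {x} 0≤-x = 0≤y-x⇒x≤y (≤-respʳ (sym (+-identityˡ (- x))) 0≤-x)

  x≤0⇒0≤-x : ∀ {x} → x ≤ 0# → 0# ≤ - x
  x≤0⇒0≤-x {x} x≤0 = ≤-respʳ (+-identityˡ (- x)) (x≤y⇒0≤y-x x≤0)

  0<x+y : ∀ {x y} → 0# < x → 0# ≤ y → 0# < x + y
  0<x+y {x} {y} 0<x 0≤y = 0≤x+y (proj₁ 0<x) 0≤y , λ 0≈x+y →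
    0<x⇒0≰-x 0<x (≤-respʳ (trans (solve 2 (λ x y → y := (x :+ y) :- x) refl x y)
      (trans (+-congʳ (sym 0≈x+y)) (+-identityˡ (- x)))) 0≤y)

  0<y+x : ∀ {x y} → 0# < x → 0# ≤ y → 0# < y + x
  0<y+x {x} {y} 0<x 0≤y = 0<-resp (+-comm x y) (0<x+y 0<x 0≤y)

  data Sign (x : Carrier) : Set (ℓ₁ ⊔ ℓ₂) where
    positive : 0# < x → Sign x
    null     : x ≈ 0# → Sign x
    negative : 0# < - x → Sign x

  sign : ∀ x → Sign x
  sign x with x ≟ 0#
  ... | yes x≈0 = null x≈0
  ... | no  x≉0 with total 0# x
  ...   | inj₁ 0≤x = positive (0≤x , λ 0≈x → x≉0 (sym 0≈x))
  ...   | inj₂ x≤0 = negative (x≤0⇒0≤-x x≤0 , λ 0≈-x → x≉0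
            (trans (solve 1 (λ x → x := :- (:- x)) refl x)
            (trans (-‿cong (sym 0≈-x)) (solve 0 (:- :0 := :0) refl))))

  pos⊎nonpos : ∀ x → 0# < x ⊎ 0# ≤ - x
  pos⊎nonpos x with sign x
  ... | positive 0<x  = inj₁ 0<x
  ... | null x≈0      = inj₂ (≤-reflexive (sym (trans (-‿cong x≈0)
                          (solve 0 (:- :0 := :0) refl))))
  ... | negative 0<-x = inj₂ (proj₁ 0<-x)

  ≤⊎> : ∀ x y → x ≤ y ⊎ 0# < x - y
  ≤⊎> x y with pos⊎nonpos (x - y)
  ... | inj₁ h = inj₂ h
  ... | inj₂ h = inj₁ (0≤y-x⇒x≤y (≤-respʳ (solve 2 (λ x y → :- (x :- y) := y :- x) refl x y) h))

  *-cancelˡ-≈0 : ∀ {x y} → x ≉ 0# → x * y ≈ 0# → y ≈ 0#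
  *-cancelˡ-≈0 {x} {y} x≉0 xy≈0 with inverse x x≉0
  ... | u , xu≈1 = trans (sym (*-identityˡ y)) (trans (*-congʳ (sym xu≈1))
    (trans (solve 3 (λ x u y → x :* u :* y := u :* (x :* y)) refl x u y)
    (trans (*-congˡ xy≈0) (zeroʳ u))))

  0<x*y : ∀ {x y} → 0# < x → 0# < y → 0# < x * y
  0<x*y (0≤x , 0≉x) (0≤y , 0≉y) = *-nonNegative 0≤x 0≤y ,
    λ 0≈xy → 0≉y (sym (*-cancelˡ-≈0 (λ x≈0 → 0≉x (sym x≈0)) (sym 0≈xy)))

  0≤x*x : ∀ x → 0# ≤ x * x
  0≤x*x x with total 0# x
  ... | inj₁ 0≤x = *-nonNegative 0≤x 0≤x
  ... | inj₂ x≤0 = ≤-respʳ (solve 1 (λ x → :- x :* :- x := x :* x) refl x)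
                     (*-nonNegative (x≤0⇒0≤-x x≤0) (x≤0⇒0≤-x x≤0))

  0<x*x : ∀ {x} → x ≉ 0# → 0# < x * x
  0<x*x x≉0 = 0≤x*x _ , λ 0≈xx → x≉0 (*-cancelˡ-≈0 x≉0 (sym 0≈xx))

  0<1 : 0# < 1#
  0<1 = 0<-resp (*-identityˡ 1#) (0<x*x 1≉0)

  -- u = x u², a positive number times a nonzero square.
  0<x⇒0<x⁻¹ : ∀ {x u} → 0# < x → x * u ≈ 1# → 0# < u
  0<x⇒0<x⁻¹ {x} {u} 0<x xu≈1 = 0<-resp
    (trans (solve 2 (λ x u → x :* (u :* u) := x :* u :* u) refl x u)
           (trans (*-congʳ xu≈1) (*-identityˡ u)))
    (0<x*y 0<x (0<x*x (λ u≈0 → 1≉0 (trans (sym xu≈1) (trans (*-congˡ u≈0) (zeroʳ x))))))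

  *-cancelˡ-0≤ : ∀ {x y} → 0# < x → 0# ≤ x * y → 0# ≤ y
  *-cancelˡ-0≤ {x} {y} 0<x 0≤xy with inverse x (λ x≈0 → proj₂ 0<x (sym x≈0))
  ... | u , xu≈1 = ≤-respʳ
    (trans (solve 3 (λ x u y → u :* (x :* y) := x :* u :* y) refl x u y)
           (trans (*-congʳ xu≈1) (*-identityˡ y)))
    (*-nonNegative (proj₁ (0<x⇒0<x⁻¹ 0<x xu≈1)) 0≤xy)

  x+y≈0⇒x≈0 : ∀ {x y} → 0# ≤ x → 0# ≤ y → x + y ≈ 0# → x ≈ 0#
  x+y≈0⇒x≈0 {x} {y} 0≤x 0≤y x+y≈0 = antisym (0≤-x⇒x≤0 (≤-respʳ
    (trans (solve 2 (λ x y → y := (x :+ y) :- x) refl x y)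
      (trans (+-congʳ x+y≈0) (+-identityˡ (- x)))) 0≤y)) 0≤x

  x+y≈0⇒y≈0 : ∀ {x y} → 0# ≤ x → 0# ≤ y → x + y ≈ 0# → y ≈ 0#
  x+y≈0⇒y≈0 {x} {y} 0≤x 0≤y x+y≈0 = x+y≈0⇒x≈0 0≤y 0≤x (trans (+-comm y x) x+y≈0)

  minimum : ∀ {x y} → 0# < x → 0# < y → ∃[ z ] 0# < z × z ≤ x × z ≤ y
  minimum {x} {y} 0<x 0<y with total x y
  ... | inj₁ x≤y = x , 0<x , ≤-refl , x≤y
  ... | inj₂ y≤x = y , 0<y , y≤x , ≤-refl

  -- Real induction. If no member of `S` reached `b`, then `S` would have a supremum s. The step at
  -- s either carries a member in [s - δ, s] beyond s, or there is no such member and s - δ is a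
  -- smaller upper bound.
  creeping : (S : Carrier → Set (c ⊔ ℓ₁ ⊔ ℓ₂)) → ∃ S →
    (∀ x → ¬ ¬ (∃[ δ ] 0# < δ × (∀ t → x - δ ≤ t → t ≤ x → S t → S (x + δ)))) →
    ∀ b → ¬ ¬ (∃[ t ] b ≤ t × S t)
  creeping S nonempty step b none =
    step s λ (δ , 0<δ , extend) → 0<x⇒0≰-x 0<δ (≤-respʳ
      (solve 2 (λ s δ → (s :- δ) :- s := :- δ) refl s δ)
      (x≤y⇒0≤y-x (least (s - δ) λ t St → bound δ 0<δ extend t St)))
    where
    bounded : IsUpperBound S b
    bounded t St with total t b
    ... | inj₁ t≤b = t≤b
    ... | inj₂ b≤t = ⊥-elim (none (t , b≤t , St))
    lub = leastUpperBound S nonempty (b , bounded)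
    s = proj₁ lub
    upper = proj₁ (proj₂ lub)
    least = proj₂ (proj₂ lub)
    bound : ∀ δ → 0# < δ → (∀ t → s - δ ≤ t → t ≤ s → S t → S (s + δ)) →
            ∀ t → S t → t ≤ s - δ
    bound δ 0<δ extend t St with total t (s - δ)
    ... | inj₁ t≤s-δ = t≤s-δ
    ... | inj₂ s-δ≤t = ⊥-elim (0<x⇒0≰-x 0<δ (≤-respʳ
      (solve 2 (λ s δ → s :- (s :+ δ) := :- δ) refl s δ)
      (x≤y⇒0≤y-x (upper (s + δ) (extend t s-δ≤t (upper t St) St)))))

  infix 4 ∣_∣≤_

  -- Two inequalities in place of an absolute value function: estimates become sums and products of
  -- nonnegative terms.
  ∣_∣≤_ : Carrier → Carrier → Set ℓ₂
  ∣ x ∣≤ a = 0# ≤ a + x × 0# ≤ a - x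

  ∣∣≤-resp : ∀ {x y a b} → x ≈ y → a ≈ b → ∣ x ∣≤ a → ∣ y ∣≤ b
  ∣∣≤-resp x≈y a≈b (l , u) = ≤-respʳ (+-cong a≈b x≈y) l , ≤-respʳ (+-cong a≈b (-‿cong x≈y)) u

  ∣∣≤-mono : ∀ {x a b} → a ≤ b → ∣ x ∣≤ a → ∣ x ∣≤ b
  ∣∣≤-mono {x} {a} {b} a≤b (l , u) =
    ≤-respʳ (solve 3 (λ a b x → (b :- a) :+ (a :+ x) := b :+ x) refl a b x)
      (0≤x+y (x≤y⇒0≤y-x a≤b) l) ,
    ≤-respʳ (solve 3 (λ a b x → (b :- a) :+ (a :- x) := b :- x) refl a b x)
      (0≤x+y (x≤y⇒0≤y-x a≤b) u)

  ∣x+y∣≤a+b : ∀ {x y a b} → ∣ x ∣≤ a → ∣ y ∣≤ b → ∣ x + y ∣≤ a + b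
  ∣x+y∣≤a+b {x} {y} {a} {b} (l , u) (l′ , u′) =
    ≤-respʳ (solve 4 (λ a b x y → (a :+ x) :+ (b :+ y) := (a :+ b) :+ (x :+ y)) refl a b x y)
      (0≤x+y l l′) ,
    ≤-respʳ (solve 4 (λ a b x y → (a :- x) :+ (b :- y) := (a :+ b) :- (x :+ y)) refl a b x y)
      (0≤x+y u u′)

  ∣-x∣≤a : ∀ {x a} → ∣ x ∣≤ a → ∣ - x ∣≤ a
  ∣-x∣≤a {x} {a} (l , u) = u , ≤-respʳ (solve 2 (λ a x → a :+ x := a :- (:- x)) refl a x) l

  0<2 : 0# < 1# + 1#
  0<2 = 0<x+y 0<1 (proj₁ 0<1)

  -- Twice a b ± x y is a sum of two products of the nonnegative numbers a ± x and b ± y, which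
  -- avoids a case distinction on signs.
  ∣x*y∣≤a*b : ∀ {x y a b} → ∣ x ∣≤ a → ∣ y ∣≤ b → ∣ x * y ∣≤ a * b
  ∣x*y∣≤a*b {x} {y} {a} {b} (l , u) (l′ , u′) =
    *-cancelˡ-0≤ 0<2 (≤-respʳ
      (solve 4 (λ a b x y → (a :+ x) :* (b :+ y) :+ (a :- x) :* (b :- y)
                            := (:1 :+ :1) :* (a :* b :+ x :* y)) refl a b x y)
      (0≤x+y (*-nonNegative l l′) (*-nonNegative u u′))) ,
    *-cancelˡ-0≤ 0<2 (≤-respʳ
      (solve 4 (λ a b x y → (a :- x) :* (b :+ y) :+ (a :+ x) :* (b :- y)
                            := (:1 :+ :1) :* (a :* b :- x :* y)) refl a b x y)
      (0≤x+y (*-nonNegative u l′) (*-nonNegative l u′)))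

  absolute : ∀ x → ∃[ a ] 0# ≤ a × ∣ x ∣≤ a
  absolute x with total 0# x
  ... | inj₁ 0≤x = x , 0≤x , 0≤x+y 0≤x 0≤x , ≤-reflexive (sym (-‿inverseʳ x))
  ... | inj₂ x≤0 = - x , 0≤-x , ≤-reflexive (sym (-‿inverseˡ x)) , 0≤x+y 0≤-x 0≤-x
    where 0≤-x = x≤0⇒0≤-x x≤0

-- The complex field, growth at infinity and pointwise Lipschitz continuity.

module ComplexNumbers {c ℓ₁ ℓ₂} (ℝ : CompleteOrderedField c ℓ₁ ℓ₂) where
  open CompleteOrderedField ℝ hiding (zero)
  open OrderedField ℝ
  open Hurwitz ℝ using (ℂ; _+i_; re; im; ℂ-rawRing)

  infix 4 _≃_

  -- A record rather than the pair of equations in `ℂ-rawRing`, so that unification can recover both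
  -- sides from the type.
  record _≃_ (z w : ℂ) : Set ℓ₁ where
    constructor _,_
    field
      re≈ : re z ≈ re w
      im≈ : im z ≈ im w

  open _≃_ public

  ℂ-commutativeRing : CommutativeRing c ℓ₁
  ℂ-commutativeRing = record
    { Carrier = ℂ
    ; _≈_ = _≃_
    ; _+_ = RawRing._+_ ℂ-rawRing
    ; _*_ = RawRing._*_ ℂ-rawRing
    ; -_  = RawRing.-_ ℂ-rawRing
    ; 0#  = RawRing.0# ℂ-rawRing
    ; 1#  = RawRing.1# ℂ-rawRing
    ; isCommutativeRing = record
      { isRing = record
        { +-isAbelianGroup = record
          { isGroup = record
            { isMonoid = record
              { isSemigroup = record
                { isMagma = record
                  { isEquivalence = record
                    { refl  = refl , refl
                    ; sym   = λ (p , q) → sym p , sym q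
                    ; trans = λ (p , q) (p′ , q′) → trans p p′ , trans q q′
                    }
                  ; ∙-cong = λ (p , q) (p′ , q′) → +-cong p p′ , +-cong q q′
                  }
                ; assoc = λ z w v → +-assoc (re z) (re w) (re v) , +-assoc (im z) (im w) (im v)
                }
              ; identity = (λ z → +-identityˡ (re z) , +-identityˡ (im z))
                         , (λ z → +-identityʳ (re z) , +-identityʳ (im z))
              }
            ; inverse = (λ z → -‿inverseˡ (re z) , -‿inverseˡ (im z))
                      , (λ z → -‿inverseʳ (re z) , -‿inverseʳ (im z))
            ; ⁻¹-cong = λ (p , q) → -‿cong p , -‿cong q
            }
          ; comm = λ z w → +-comm (re z) (re w) , +-comm (im z) (im w)
          }
        ; *-cong = λ (p , q) (p′ , q′) → +-cong (*-cong p p′) (-‿cong (*-cong q q′))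
                                       , +-cong (*-cong p q′) (*-cong q p′)
        ; *-assoc = λ (a +i b) (a′ +i b′) (a″ +i b″) →
            solve 6 (λ a b a′ b′ a″ b″ →
              (a :* a′ :- b :* b′) :* a″ :- (a :* b′ :+ b :* a′) :* b″
              := a :* (a′ :* a″ :- b′ :* b″) :- b :* (a′ :* b″ :+ b′ :* a″))
              refl a b a′ b′ a″ b″ ,
            solve 6 (λ a b a′ b′ a″ b″ →
              (a :* a′ :- b :* b′) :* b″ :+ (a :* b′ :+ b :* a′) :* a″
              := a :* (a′ :* b″ :+ b′ :* a″) :+ b :* (a′ :* a″ :- b′ :* b″))
              refl a b a′ b′ a″ b″
        ; *-identity = (λ (a +i b) →
            solve 2 (λ a b → :1 :* a :- :0 :* b := a) refl a b ,
            solve 2 (λ a b → :1 :* b :+ :0 :* a := b) refl a b)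
          , (λ (a +i b) →
            solve 2 (λ a b → a :* :1 :- b :* :0 := a) refl a b ,
            solve 2 (λ a b → a :* :0 :+ b :* :1 := b) refl a b)
        ; distrib = (λ (a +i b) (a′ +i b′) (a″ +i b″) →
            solve 6 (λ a b a′ b′ a″ b″ → a :* (a′ :+ a″) :- b :* (b′ :+ b″)
              := (a :* a′ :- b :* b′) :+ (a :* a″ :- b :* b″)) refl a b a′ b′ a″ b″ ,
            solve 6 (λ a b a′ b′ a″ b″ → a :* (b′ :+ b″) :+ b :* (a′ :+ a″)
              := (a :* b′ :+ b :* a′) :+ (a :* b″ :+ b :* a″)) refl a b a′ b′ a″ b″)
          , (λ (a +i b) (a′ +i b′) (a″ +i b″) →
            solve 6 (λ a b a′ b′ a″ b″ → (a′ :+ a″) :* a :- (b′ :+ b″) :* b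
              := (a′ :* a :- b′ :* b) :+ (a″ :* a :- b″ :* b)) refl a b a′ b′ a″ b″ ,
            solve 6 (λ a b a′ b′ a″ b″ → (a′ :+ a″) :* b :+ (b′ :+ b″) :* a
              := (a′ :* b :+ b′ :* a) :+ (a″ :* b :+ b″ :* a)) refl a b a′ b′ a″ b″)
        }
      ; *-comm = λ (a +i b) (a′ +i b′) →
          solve 4 (λ a b a′ b′ → a :* a′ :- b :* b′ := a′ :* a :- b′ :* b) refl a b a′ b′ ,
          solve 4 (λ a b a′ b′ → a :* b′ :+ b :* a′ := a′ :* b :+ b′ :* a) refl a b a′ b′
      }
    }

  module 𝐂 = CommutativeRing ℂ-commutativeRing
  module 𝐂-Solver = IntegerSolver ℂ-commutativeRing
  open MonicPolynomial ℂ-commutativeRing public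

  ι : Carrier → ℂ
  ι a = a +i 0#

  𝐢 : ℂ
  𝐢 = 0# +i 1#

  -- The real part of z times the conjugate of w.
  ⟨_,_⟩ : ℂ → ℂ → Carrier
  ⟨ z , w ⟩ = re z * re w + im z * im w

  ∥_∥² : ℂ → Carrier
  ∥ z ∥² = ⟨ z , z ⟩

  ⟨⟩-cong : ∀ {z z′ w w′} → z ≃ z′ → w ≃ w′ → ⟨ z , w ⟩ ≈ ⟨ z′ , w′ ⟩
  ⟨⟩-cong (p , q) (p′ , q′) = +-cong (*-cong p p′) (*-cong q q′)

  ⟨⟩-*ˡ : ∀ u z w → ⟨ u 𝐂.* z , u 𝐂.* w ⟩ ≈ ∥ u ∥² * ⟨ z , w ⟩
  ⟨⟩-*ˡ (u +i v) (a +i b) (a′ +i b′) = solve 6 (λ u v a b a′ b′ →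
    (u :* a :- v :* b) :* (u :* a′ :- v :* b′) :+ (u :* b :+ v :* a) :* (u :* b′ :+ v :* a′)
    := (u :* u :+ v :* v) :* (a :* a′ :+ b :* b′)) refl u v a b a′ b′

  ∥∥²-* : ∀ z w → ∥ z 𝐂.* w ∥² ≈ ∥ z ∥² * ∥ w ∥²
  ∥∥²-* z w = ⟨⟩-*ˡ z w w

  0≤∥∥² : ∀ z → 0# ≤ ∥ z ∥²
  0≤∥∥² z = 0≤x+y (0≤x*x (re z)) (0≤x*x (im z))

  x*x≈0⇒x≈0 : ∀ {x} → x * x ≈ 0# → x ≈ 0#
  x*x≈0⇒x≈0 {x} xx≈0 with x ≟ 0#
  ... | yes x≈0 = x≈0
  ... | no  x≉0 = *-cancelˡ-≈0 x≉0 xx≈0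

  ∥z∥²≈0⇒z≃0 : ∀ {z} → ∥ z ∥² ≈ 0# → z ≃ 𝐂.0#
  ∥z∥²≈0⇒z≃0 {z} h =
    x*x≈0⇒x≈0 (x+y≈0⇒x≈0 (0≤x*x (re z)) (0≤x*x (im z)) h) ,
    x*x≈0⇒x≈0 (x+y≈0⇒y≈0 (0≤x*x (re z)) (0≤x*x (im z)) h)

  0<∥z∥² : ∀ {z} → ¬ z ≃ 𝐂.0# → 0# < ∥ z ∥²
  0<∥z∥² {z} z≄0 = 0≤∥∥² z , λ 0≈ → z≄0 (∥z∥²≈0⇒z≃0 (sym 0≈))

  0<∥z∥²⇒z≄0 : ∀ {z} → 0# < ∥ z ∥² → ¬ z ≃ 𝐂.0#
  0<∥z∥²⇒z≄0 (_ , 0≉) z≃0 = 0≉ (sym (trans (⟨⟩-cong z≃0 z≃0)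
    (solve 0 (:0 :* :0 :+ :0 :* :0 := :0) refl)))

  0<re⇒0<∥∥² : ∀ {z} → 0# < re z → 0# < ∥ z ∥²
  0<re⇒0<∥∥² {z} 0<re = 0<x+y (0<x*y 0<re 0<re) (0≤x*x (im z))

  _≟ᶜ0 : ∀ z → Dec (z ≃ 𝐂.0#)
  z ≟ᶜ0 with re z ≟ 0# | im z ≟ 0#
  ... | yes p | yes q = yes (p , q)
  ... | no ¬p | _     = no λ h → ¬p (re≈ h)
  ... | _     | no ¬q = no λ h → ¬q (im≈ h)

  -- Growth at infinity

  mutual
    -- With b = z g(z), 2|a + b|² = |2a + b|² + |b|² - 2|a|², and |b|² ≥ |z|² as soon as |g(z)| ≥ 1.
    -- Hence the margin `B` = 2M + 2|a|² suffices, without a triangle inequality.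
    growth : ∀ {n} (p : Vec ℂ (suc n)) {M} → 0# ≤ M →
      ∃[ R ] 0# ≤ R × (∀ z → R ≤ ∥ z ∥² → M ≤ ∥ eval p z ∥²)
    growth (a ∷ p) {M} 0≤M with eventually≥1 p
    ... | R , 0≤R , p≥1 = R + B , 0≤x+y 0≤R 0≤B , λ z R+B≤ →
      let g = eval p z
          R≤ = ≤-trans (0≤y-x⇒x≤y (≤-respʳ (solve 2 (λ r b → b := (r :+ b) :- r) refl R B) 0≤B)) R+B≤
          rest = 0≤x+y (0≤x+y (*-nonNegative (0≤∥∥² z) (x≤y⇒0≤y-x (p≥1 z R≤))) (x≤y⇒0≤y-x R+B≤))
                       (0≤x+y 0≤R (0≤∥∥² ((a 𝐂.+ a) 𝐂.+ z 𝐂.* g)))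
      in 0≤y-x⇒x≤y (*-cancelˡ-0≤ 0<2 (≤-respʳ (identity a (z 𝐂.* g) z g (sym (∥∥²-* z g))) rest))
      where
      B = (M + M) + (∥ a ∥² + ∥ a ∥²)
      0≤B : 0# ≤ B
      0≤B = 0≤x+y (0≤x+y 0≤M 0≤M) (0≤x+y (0≤∥∥² a) (0≤∥∥² a))
      identity : ∀ a b z g → ∥ z ∥² * ∥ g ∥² ≈ ∥ b ∥² →
        (∥ z ∥² * (∥ g ∥² - 1#) + (∥ z ∥² - (R + ((M + M) + (∥ a ∥² + ∥ a ∥²)))))
          + (R + ∥ (a 𝐂.+ a) 𝐂.+ b ∥²)
        ≈ (1# + 1#) * (∥ a 𝐂.+ b ∥² - M)
      identity (x +i y) (u +i v) z g h = trans
        (solve 8 (λ x y u v Z G R M →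
          (Z :* (G :- :1) :+ (Z :- (R :+ ((M :+ M) :+ ((x :* x :+ y :* y) :+ (x :* x :+ y :* y))))))
          :+ (R :+ (((x :+ x) :+ u) :* ((x :+ x) :+ u) :+ ((y :+ y) :+ v) :* ((y :+ y) :+ v)))
          := (Z :* G :- (u :* u :+ v :* v))
             :+ (:1 :+ :1) :* (((x :+ u) :* (x :+ u) :+ (y :+ v) :* (y :+ v)) :- M))
          refl x y u v ∥ z ∥² ∥ g ∥² R M)
        (trans (+-congʳ (trans (+-congʳ h) (-‿inverseʳ _))) (+-identityˡ _))

    eventually≥1 : ∀ {n} (p : Vec ℂ n) →
      ∃[ R ] 0# ≤ R × (∀ z → R ≤ ∥ z ∥² → 1# ≤ ∥ eval p z ∥²)
    eventually≥1 []        = 0# , ≤-refl , λ z _ → ≤-reflexive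
      (solve 0 (:1 := :1 :* :1 :+ :0 :* :0) refl)
    eventually≥1 p@(_ ∷ _) = growth p (proj₁ 0<1)

  -- Lipschitz continuity at a point

  Near : Carrier → ℂ → ℂ → Set ℓ₂
  Near δ z w = ∣ re w - re z ∣≤ δ × ∣ im w - im z ∣≤ δ

  -- A linear modulus at one point, over squares of half-side δ. The cap δ ≤ 1 bounds f near z by |f
  -- z| + K, which closes the class under products.
  LipschitzAt : ℂ → (ℂ → Carrier) → Set (c ⊔ ℓ₂)
  LipschitzAt z f = ∃[ K ] 0# ≤ K × (∀ δ w → 0# ≤ δ → δ ≤ 1# → Near δ z w → ∣ f w - f z ∣≤ K * δ)

  module _ {z : ℂ} where

    lip-const : ∀ a → LipschitzAt z (λ _ → a)
    lip-const a = 0# , ≤-refl , λ δ w _ _ _ →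
      ≤-reflexive (solve 2 (λ a δ → :0 := :0 :* δ :+ (a :- a)) refl a δ) ,
      ≤-reflexive (solve 2 (λ a δ → :0 := :0 :* δ :- (a :- a)) refl a δ)

    lip-re : LipschitzAt z re
    lip-re = 1# , proj₁ 0<1 , λ δ w _ _ near → ∣∣≤-resp refl (sym (*-identityˡ δ)) (proj₁ near)

    lip-im : LipschitzAt z im
    lip-im = 1# , proj₁ 0<1 , λ δ w _ _ near → ∣∣≤-resp refl (sym (*-identityˡ δ)) (proj₂ near)

    lip-+ : ∀ {f g} → LipschitzAt z f → LipschitzAt z g → LipschitzAt z (λ w → f w + g w)
    lip-+ {f} {g} (K , 0≤K , F) (L , 0≤L , G) = K + L , 0≤x+y 0≤K 0≤L , λ δ w 0≤δ δ≤1 near →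
      ∣∣≤-resp
        (solve 4 (λ f f₀ g g₀ → (f :- f₀) :+ (g :- g₀) := (f :+ g) :- (f₀ :+ g₀)) refl
          (f w) (f z) (g w) (g z))
        (sym (distribʳ δ K L))
        (∣x+y∣≤a+b (F δ w 0≤δ δ≤1 near) (G δ w 0≤δ δ≤1 near))

    lip-neg : ∀ {f} → LipschitzAt z f → LipschitzAt z (λ w → - f w)
    lip-neg {f} (K , 0≤K , F) = K , 0≤K , λ δ w 0≤δ δ≤1 near → ∣∣≤-resp
      (solve 2 (λ f f₀ → :- (f :- f₀) := (:- f) :- (:- f₀)) refl (f w) (f z)) refl
      (∣-x∣≤a (F δ w 0≤δ δ≤1 near))

    lip-* : ∀ {f g} → LipschitzAt z f → LipschitzAt z g → LipschitzAt z (λ w → f w * g w)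
    lip-* {f} {g} (K , 0≤K , F) (L , 0≤L , G) with absolute (f z) | absolute (g z)
    ... | A , 0≤A , ∣f∣≤A | B , 0≤B , ∣g∣≤B =
      (K + A) * L + K * B , 0≤x+y (*-nonNegative (0≤x+y 0≤K 0≤A) 0≤L) (*-nonNegative 0≤K 0≤B) ,
      λ δ w 0≤δ δ≤1 near →
        let Fδ = F δ w 0≤δ δ≤1 near
            Kδ≤K = 0≤y-x⇒x≤y (≤-respʳ
              (solve 2 (λ K δ → K :* (:1 :- δ) := K :- K :* δ) refl K δ)
              (*-nonNegative 0≤K (x≤y⇒0≤y-x δ≤1)))
            ∣f∣≤K+A = ∣∣≤-resp (solve 2 (λ f f₀ → (f :- f₀) :+ f₀ := f) refl (f w) (f z)) refl
              (∣x+y∣≤a+b (∣∣≤-mono Kδ≤K Fδ) ∣f∣≤A)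
        in ∣∣≤-resp
          (solve 4 (λ f f₀ g g₀ → f :* (g :- g₀) :+ (f :- f₀) :* g₀ := f :* g :- f₀ :* g₀) refl
            (f w) (f z) (g w) (g z))
          (solve 5 (λ K A L B δ → (K :+ A) :* (L :* δ) :+ K :* δ :* B
                                  := ((K :+ A) :* L :+ K :* B) :* δ) refl K A L B δ)
          (∣x+y∣≤a+b (∣x*y∣≤a*b ∣f∣≤K+A (G δ w 0≤δ δ≤1 near)) (∣x*y∣≤a*b Fδ ∣g∣≤B))

    LipschitzAtᶜ : (ℂ → ℂ) → Set (c ⊔ ℓ₂)
    LipschitzAtᶜ f = LipschitzAt z (λ w → re (f w)) × LipschitzAt z (λ w → im (f w))

    lipᶜ-const : ∀ a → LipschitzAtᶜ (λ _ → a)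
    lipᶜ-const a = lip-const (re a) , lip-const (im a)

    lipᶜ-id : LipschitzAtᶜ (λ w → w)
    lipᶜ-id = lip-re , lip-im

    lipᶜ-+ : ∀ {f g} → LipschitzAtᶜ f → LipschitzAtᶜ g → LipschitzAtᶜ (λ w → f w 𝐂.+ g w)
    lipᶜ-+ (f₁ , f₂) (g₁ , g₂) = lip-+ f₁ g₁ , lip-+ f₂ g₂

    lipᶜ-* : ∀ {f g} → LipschitzAtᶜ f → LipschitzAtᶜ g → LipschitzAtᶜ (λ w → f w 𝐂.* g w)
    lipᶜ-* (f₁ , f₂) (g₁ , g₂) =
      lip-+ (lip-* f₁ g₁) (lip-neg (lip-* f₂ g₂)) , lip-+ (lip-* f₁ g₂) (lip-* f₂ g₁)

    lipᶜ-eval : ∀ {n} (p : Vec ℂ n) {f} → LipschitzAtᶜ f → LipschitzAtᶜ (λ w → eval p (f w))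
    lipᶜ-eval []      F = lipᶜ-const 𝐂.1#
    lipᶜ-eval (a ∷ p) F = lipᶜ-+ (lipᶜ-const a) (lipᶜ-* F (lipᶜ-eval p F))

    lip-⟨⟩ : ∀ {f g} → LipschitzAtᶜ f → LipschitzAtᶜ g → LipschitzAt z (λ w → ⟨ f w , g w ⟩)
    lip-⟨⟩ (f₁ , f₂) (g₁ , g₂) = lip-+ (lip-* f₁ g₁) (lip-* f₂ g₂)

    -- With s = f z, take δ = s / (K + s): then δ ≤ 1 and s - K δ = s δ > 0.
    stays-positive : ∀ {f} → LipschitzAt z f → 0# < f z →
      ∃[ δ ] 0# < δ × δ ≤ 1# × (∀ w → Near δ z w → 0# < f w)
    stays-positive {f} (K , 0≤K , F) 0<s with inverse (K + f z) (λ h → proj₂ (0<y+x 0<s 0≤K) (sym h))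
    ... | u , [K+s]u≈1 = s * u , 0<δ , δ≤1 , λ w near →
      0<-resp (solve 2 (λ a b → a :+ (b :- a) := b) refl (s - K * (s * u)) (f w))
        (0<x+y (0<-resp (sym s-Kδ≈ssu) (0<x*y 0<s 0<δ))
          (≤-respʳ (solve 3 (λ k f s → k :+ (f :- s) := f :- (s :- k)) refl (K * (s * u)) (f w) s)
            (proj₁ (F (s * u) w (proj₁ 0<δ) δ≤1 near))))
      where
      s = f z
      0<u : 0# < u
      0<u = 0<x⇒0<x⁻¹ (0<y+x 0<s 0≤K) [K+s]u≈1
      0<δ : 0# < s * u
      0<δ = 0<x*y 0<s 0<u
      δ≤1 : s * u ≤ 1#
      δ≤1 = 0≤y-x⇒x≤y (≤-respʳ
        (trans (solve 3 (λ K s u → K :* u := (K :+ s) :* u :- s :* u) refl K s u) (+-congʳ [K+s]u≈1))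
        (*-nonNegative 0≤K (proj₁ 0<u)))
      s-Kδ≈ssu : s - K * (s * u) ≈ s * (s * u)
      s-Kδ≈ssu = trans (+-congʳ (trans (sym (*-identityʳ s)) (*-congˡ (sym [K+s]u≈1))))
        (solve 3 (λ K s u → s :* ((K :+ s) :* u) :- K :* (s :* u) := s :* (s :* u)) refl K s u)

-- Compactness of a square, and why descent cannot be possible everywhere.

module Compactness {c ℓ₁ ℓ₂} (ℝ : CompleteOrderedField c ℓ₁ ℓ₂) where
  open CompleteOrderedField ℝ hiding (zero)
  open OrderedField ℝ
  open ComplexNumbers ℝ
  open Hurwitz ℝ using (ℂ; _+i_; re; im)

  -- Heine-Borel by creeping along the right end of the covered interval; `merge` fuses the cover so
  -- far with the local one, so that a single index remains instead of a finite subcover.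
  compact : {W : Set (c ⊔ ℓ₁ ⊔ ℓ₂)} (Covers : W → Carrier → Set (c ⊔ ℓ₁ ⊔ ℓ₂)) → W →
    (∀ u v → ∃[ w ] ∀ y → Covers u y ⊎ Covers v y → Covers w y) →
    (∀ y → ¬ ¬ (∃[ w ] ∃[ δ ] 0# < δ × (∀ y′ → ∣ y′ - y ∣≤ δ → Covers w y′))) →
    ∀ a b → ¬ ¬ (∃[ w ] ∀ y → a ≤ y → y ≤ b → Covers w y)
  compact Covers w₀ merge local a b none =
    creeping (λ t → ∃[ w ] ∀ y → a ≤ y → y ≤ t → Covers w y)
      -- No y lies between a and a - 1, so any index covers this interval.
      (a - 1# , w₀ , λ y a≤y y≤a-1 → ⊥-elim (0<x⇒0≰-x 0<1 (≤-respʳ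
        (solve 1 (λ a → a :- :1 :- a := :- :1) refl a)
        (x≤y⇒0≤y-x (≤-trans a≤y y≤a-1)))))
      (λ x k → local x λ (w , δ , 0<δ , covers) → k (δ , 0<δ , λ t x-δ≤t t≤x (u , covers′) →
        let (v , v-covers) = merge u w in
        v , λ y a≤y y≤x+δ → v-covers y (extend (covers′ y a≤y) (covers y) x-δ≤t y≤x+δ)))
      b λ (t , b≤t , w , covers) → none (w , λ y a≤y y≤b → covers y a≤y (≤-trans y≤b b≤t))
    where
    extend : ∀ {p q} {P : Set p} {Q : Set q} {x y t δ} → (y ≤ t → P) → (∣ y - x ∣≤ δ → Q) →
      x - δ ≤ t → y ≤ x + δ → P ⊎ Q
    extend {x = x} {y} {t} {δ} f g x-δ≤t y≤x+δ with total y t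
    ... | inj₁ y≤t = inj₁ (f y≤t)
    ... | inj₂ t≤y = inj₂ (g
      ( ≤-respʳ (solve 3 (λ x y δ → y :- (x :- δ) := δ :+ (y :- x)) refl x y δ)
          (x≤y⇒0≤y-x (≤-trans x-δ≤t t≤y))
      , ≤-respʳ (solve 3 (λ x y δ → x :+ δ :- y := δ :- (y :- x)) refl x y δ)
          (x≤y⇒0≤y-x y≤x+δ)))

  module _ {n} (p : Vec ℂ (suc n)) where

    ∣p∣² : ℂ → Carrier
    ∣p∣² z = ∥ eval p z ∥²

    Below : ℂ → ℂ → Set (ℓ₁ ⊔ ℓ₂)
    Below w z = 0# < ∣p∣² z - ∣p∣² w

    below-mono : ∀ {w v z} → ∣p∣² v ≤ ∣p∣² w → Below w z → Below v z
    below-mono {w} {v} {z} v≤w w<z = 0<-resp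
      (solve 3 (λ z w v → (z :- w) :+ (w :- v) := z :- v) refl (∣p∣² z) (∣p∣² w) (∣p∣² v))
      (0<x+y w<z (x≤y⇒0≤y-x v≤w))

    lesser : ∀ w v → ∃[ u ] ∣p∣² u ≤ ∣p∣² w × ∣p∣² u ≤ ∣p∣² v
    lesser w v with total (∣p∣² w) (∣p∣² v)
    ... | inj₁ w≤v = w , ≤-refl , w≤v
    ... | inj₂ v≤w = v , v≤w , ≤-refl

    module _ (descent : ∀ z → ¬ ¬ (∃[ w ] Below w z)) (a b : Carrier) where

      private
        -- The half-width of a vertical strip travels with the point: compactness in y must produce
        -- one width for the whole segment over x₀ (tube lemma), so that compactness in x can
        -- follow.
        Witness = (∃[ δ ] 0# < δ) × ℂ

        w₀ : Witness
        w₀ = (1# , 0<1) , 𝐂.0#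

        Strip : Carrier → Witness → Carrier → Set _
        Strip x₀ ((δ , _) , w) y = ∀ x → ∣ x - x₀ ∣≤ δ → Below w (x +i y)

        Segment : Witness → Carrier → Set _
        Segment (_ , w) x = ∀ y → a ≤ y → y ≤ b → Below w (x +i y)

        merge-strips : ∀ x₀ u v → ∃[ w ] ∀ y → Strip x₀ u y ⊎ Strip x₀ v y → Strip x₀ w y
        merge-strips x₀ ((δ , 0<δ) , u) ((ε , 0<ε) , v) with minimum 0<δ 0<ε | lesser u v
        ... | η , 0<η , η≤δ , η≤ε | w , w≤u , w≤v = ((η , 0<η) , w) , λ where
          y (inj₁ s) x near → below-mono w≤u (s x (∣∣≤-mono η≤δ near))
          y (inj₂ s) x near → below-mono w≤v (s x (∣∣≤-mono η≤ε near))

        merge-segments : ∀ u v → ∃[ w ] ∀ x → Segment u x ⊎ Segment v x → Segment w x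
        merge-segments (δ , u) (_ , v) with lesser u v
        ... | w , w≤u , w≤v = (δ , w) , λ where
          x (inj₁ s) y a≤y y≤b → below-mono w≤u (s y a≤y y≤b)
          x (inj₂ s) y a≤y y≤b → below-mono w≤v (s y a≤y y≤b)

        local-strip : ∀ x₀ y₀ →
          ¬ ¬ (∃[ w ] ∃[ δ ] 0# < δ × (∀ y → ∣ y - y₀ ∣≤ δ → Strip x₀ w y))
        local-strip x₀ y₀ none = descent (x₀ +i y₀) λ (w , w<z) →
          let (δ , 0<δ , _ , persists) = stays-positive
                (lip-+ (lip-⟨⟩ (lipᶜ-eval p lipᶜ-id) (lipᶜ-eval p lipᶜ-id)) (lip-const (- ∣p∣² w))) w<z
          in none (((δ , 0<δ) , w) , δ , 0<δ , λ y near x near′ → persists (x +i y) (near′ , near))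

        local-segment : ∀ x₀ → ¬ ¬ (∃[ w ] ∃[ δ ] 0# < δ × (∀ x → ∣ x - x₀ ∣≤ δ → Segment w x))
        local-segment x₀ none =
          compact (Strip x₀) w₀ (merge-strips x₀) (local-strip x₀) a b λ (w@((δ , 0<δ) , _) , s) →
            none (w , δ , 0<δ , λ x near y a≤y y≤b → s y a≤y y≤b x near)

      below-square : ¬ ¬ (∃[ w ] ∀ x y → a ≤ x → x ≤ b → a ≤ y → y ≤ b → Below w (x +i y))
      below-square none = compact Segment w₀ merge-segments local-segment a b
        λ ((_ , w) , s) → none (w , λ x y a≤x x≤b → s x a≤x x≤b y)

    -- A half-side of 1 + r needs no square root of r; the bound follows from 2(x + 1 + r) = 2(r -
    -- x²) + (x² + 1) + (x + 1)².
    x*x≤r⇒-[1+r]≤x : ∀ {x r} → x * x ≤ r → - (1# + r) ≤ x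
    x*x≤r⇒-[1+r]≤x {x} {r} xx≤r = 0≤y-x⇒x≤y (*-cancelˡ-0≤ 0<2 (≤-respʳ
      (solve 2 (λ x r → ((r :- x :* x) :+ (r :- x :* x)) :+ ((x :* x :+ :1) :+ (x :+ :1) :* (x :+ :1))
        := (:1 :+ :1) :* (x :- (:- (:1 :+ r)))) refl x r)
      (0≤x+y (0≤x+y 0≤r-xx 0≤r-xx) (0≤x+y (0≤x+y (0≤x*x x) (proj₁ 0<1)) (0≤x*x (x + 1#))))))
      where 0≤r-xx = x≤y⇒0≤y-x xx≤r

    x*x≤r⇒x≤1+r : ∀ {x r} → x * x ≤ r → x ≤ 1# + r
    x*x≤r⇒x≤1+r {x} {r} xx≤r = 0≤y-x⇒x≤y (≤-respʳ
      (solve 2 (λ x r → (:- x) :- (:- (:1 :+ r)) := (:1 :+ r) :- x) refl x r)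
      (x≤y⇒0≤y-x (x*x≤r⇒-[1+r]≤x (≤-respˡ (solve 1 (λ x → x :* x := (:- x) :* (:- x)) refl x) xx≤r))))

    no-descent : ¬ (∀ z → ¬ ¬ (∃[ w ] Below w z))
    -- The threshold |p(0)|² traps w: lying below 0, it cannot satisfy |w|² ≥ R, so it is in the
    -- square and would lie below itself.
    no-descent descent with growth p {∣p∣² 𝐂.0#} (0≤∥∥² _)
    ... | R , 0≤R , large = below-square descent (- (1# + R)) (1# + R) λ (w , below) →
      let 00≤R = ≤-respˡ (sym (zeroʳ 0#)) 0≤R
          w<0 = below 0# 0# (x*x≤r⇒-[1+r]≤x 00≤R) (x*x≤r⇒x≤1+r 00≤R)
                            (x*x≤r⇒-[1+r]≤x 00≤R) (x*x≤r⇒x≤1+r 00≤R)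
          0≰w = λ 0≤w → 0<x⇒0≰-x w<0 (≤-respʳ
            (solve 2 (λ u v → u :- v := :- (v :- u)) refl (∣p∣² w) (∣p∣² 𝐂.0#)) (x≤y⇒0≤y-x 0≤w))
      in impossible w below 0≰w
      where
      impossible : ∀ w → (∀ x y → - (1# + R) ≤ x → x ≤ 1# + R → - (1# + R) ≤ y → y ≤ 1# + R →
        Below w (x +i y)) → ¬ (∣p∣² 𝐂.0# ≤ ∣p∣² w) → ⊥
      impossible w below 0≰w with ≤⊎> R ∥ w ∥²
      ... | inj₁ R≤w = 0≰w (large w R≤w)
      ... | inj₂ w<R = proj₂ (below (re w) (im w) (x*x≤r⇒-[1+r]≤x xx≤R) (x*x≤r⇒x≤1+r xx≤R)
                                                  (x*x≤r⇒-[1+r]≤x yy≤R) (x*x≤r⇒x≤1+r yy≤R))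
                         (sym (-‿inverseʳ (∣p∣² w)))
        where
        xx≤R : re w * re w ≤ R
        xx≤R = 0≤y-x⇒x≤y (≤-respʳ
          (solve 3 (λ R x y → (R :- (x :* x :+ y :* y)) :+ y :* y := R :- x :* x) refl R (re w) (im w))
          (0≤x+y (proj₁ w<R) (0≤x*x (im w))))
        yy≤R : im w * im w ≤ R
        yy≤R = 0≤y-x⇒x≤y (≤-respʳ
          (solve 3 (λ R x y → (R :- (x :* x :+ y :* y)) :+ x :* x := R :- y :* y) refl R (re w) (im w))
          (0≤x+y (proj₁ w<R) (0≤x*x (re w))))

-- Real and complex square roots.

module SquareRoots {c ℓ₁ ℓ₂} (ℝ : CompleteOrderedField c ℓ₁ ℓ₂) where
  open CompleteOrderedField ℝ hiding (zero)
  open OrderedField ℝ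
  open ComplexNumbers ℝ
  open Hurwitz ℝ using (ℂ; _+i_; re; im)

  -- Without a root, a - x² has a strict sign at every x, which persists nearby. Where it is
  -- positive, x + δ still has its square below a; where it is negative, no t close to x does, and
  -- the creeping step is void. So creeping would reach a + 1, whose square exceeds a.
  sqrt : ∀ {a} → 0# ≤ a → ¬ ¬ (∃[ s ] 0# ≤ s × s * s ≈ a)
  sqrt {a} 0≤a none with a ≟ 0#
  -- For a = 0 the strict condition t² < a below would already exclude the starting point 0.
  ... | yes a≈0 = none (0# , ≤-refl , trans (zeroʳ 0#) (sym a≈0))
  ... | no  a≉0 = creeping (λ t → Lift c (0# < a - t * t))
    (0# , lift (0<-resp (solve 1 (λ a → a := a :- :0 :* :0) refl a)
                  (0≤a , λ 0≈a → a≉0 (sym 0≈a))))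
    step (a + 1#) λ (t , a+1≤t , lift tt<a) → too-large t a+1≤t tt<a
    where
    too-large : ∀ t → a + 1# ≤ t → ¬ (0# < a - t * t)
    too-large t a+1≤t tt<a = 0<x⇒0≰-x tt<a (≤-respʳ
      (solve 2 (λ a t → let b = a :+ :1; e = t :- b in
          (e :* e :+ (b :* e :+ b :* e)) :+ (a :* a :+ b) := :- (a :- t :* t)) refl a t)
        (0≤x+y (0≤x+y (0≤x*x (t - (a + 1#))) (0≤x+y (*-nonNegative 0≤a+1 0≤e) (*-nonNegative 0≤a+1 0≤e)))
               (0≤x+y (0≤x*x a) 0≤a+1)))
      where
      0≤a+1 = 0≤x+y 0≤a (proj₁ 0<1)
      0≤e   = x≤y⇒0≤y-x a+1≤t
    root : ∀ x → x * x ≈ a → ⊥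
    root x xx≈a with total 0# x
    ... | inj₁ 0≤x = none (x , 0≤x , xx≈a)
    ... | inj₂ x≤0 = none (- x , x≤0⇒0≤-x x≤0 ,
      trans (solve 1 (λ x → (:- x) :* (:- x) := x :* x) refl x) xx≈a)
    -- A function on ℂ, used on the real axis, so that the Lipschitz calculus applies.
    gap : ℂ → Carrier
    gap z = a - re z * re z
    lip : ∀ z → LipschitzAt z gap
    lip z = lip-+ (lip-const a) (lip-neg (lip-* lip-re lip-re))
    near : ∀ x t δ → 0# ≤ δ → ∣ t - x ∣≤ δ → Near δ (ι x) (ι t)
    near x t δ 0≤δ h = h , (≤-respʳ (solve 1 (λ δ → δ := δ :+ (:0 :- :0)) refl δ) 0≤δ
                             , ≤-respʳ (solve 1 (λ δ → δ := δ :- (:0 :- :0)) refl δ) 0≤δ)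
    step : ∀ x → ¬ ¬ (∃[ δ ] 0# < δ × (∀ t → x - δ ≤ t → t ≤ x →
      Lift c (0# < a - t * t) → Lift c (0# < a - (x + δ) * (x + δ))))
    step x k with sign (a - x * x)
    ... | null h = root x (sym (trans (solve 2 (λ a x → a := (a :- x :* x) :+ x :* x) refl a x)
                     (trans (+-congʳ h) (+-identityˡ _))))
    ... | positive h =
      let (δ , 0<δ , _ , persists) = stays-positive (lip (ι x)) h in
      k (δ , 0<δ , λ _ _ _ _ → lift (persists (ι (x + δ)) (near x (x + δ) δ (proj₁ 0<δ)
        ( ≤-respʳ (solve 2 (λ x δ → δ :+ δ := δ :+ (x :+ δ :- x)) refl x δ) (0≤x+y (proj₁ 0<δ) (proj₁ 0<δ))
        , ≤-reflexive (solve 2 (λ x δ → :0 := δ :- (x :+ δ :- x)) refl x δ)))))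
    ... | negative h =
      let (δ , 0<δ , _ , persists) = stays-positive (lip-neg (lip (ι x))) h in
      k (δ , 0<δ , λ t x-δ≤t t≤x (lift tt<a) → ⊥-elim (0<x⇒0≰-x tt<a
      (proj₁ (persists (ι t) (near x t δ (proj₁ 0<δ)
        ( ≤-respʳ (solve 3 (λ x δ t → t :- (x :- δ) := δ :+ (t :- x)) refl x δ t) (x≤y⇒0≤y-x x-δ≤t)
        , ≤-respʳ (solve 3 (λ x δ t → δ :+ (x :- t) := δ :- (t :- x)) refl x δ t)
            (0≤x+y (proj₁ 0<δ) (x≤y⇒0≤y-x t≤x))))))))

  a*a≤n*n⇒0≤n+a : ∀ {n a} → 0# ≤ n → a * a ≤ n * n → 0# ≤ n + a
  a*a≤n*n⇒0≤n+a {n} {a} 0≤n aa≤nn with sign (n + a)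
  ... | positive h = proj₁ h
  ... | null h     = ≤-reflexive (sym h)
  ... | negative h = ⊥-elim (0<x⇒0≰-x
    (0<x*y (0<-resp (solve 2 (λ n a → :- (n :+ a) :+ (n :+ n) := n :- a) refl n a)
             (0<x+y h (0≤x+y 0≤n 0≤n))) h)
    (≤-respʳ (solve 2 (λ n a → n :* n :- a :* a := :- ((n :- a) :* (:- (n :+ a)))) refl n a)
      (x≤y⇒0≤y-x aa≤nn)))

  -- With n = |z|, p² = (n + a)/2 and q² = (n - a)/2 give p² - q² = a and (2pq)² = b². Hence 2pq = ±
  -- b, and the sign decides between p + iq and p - iq.
  complex-sqrt : ∀ z → ¬ ¬ (∃[ u ] u 𝐂.* u ≃ z)
  complex-sqrt z@(a +i b) none = sqrt (0≤∥∥² z) λ (n , 0≤n , nn≈) →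
    sqrt (*-nonNegative (0≤n+a n 0≤n nn≈) 0≤½) λ (p , _ , pp≈) →
    sqrt (*-nonNegative (0≤n-a n 0≤n nn≈) 0≤½) λ (q , _ , qq≈) →
    choose p q (real n p q pp≈ qq≈) (imaginary n p q nn≈ pp≈ qq≈)
    where
    2# = 1# + 1#
    ½ : Carrier
    ½ = proj₁ (inverse 2# (λ h → proj₂ 0<2 (sym h)))
    2½≈1 : 2# * ½ ≈ 1#
    2½≈1 = proj₂ (inverse 2# (λ h → proj₂ 0<2 (sym h)))
    0≤½ : 0# ≤ ½
    0≤½ = proj₁ (0<x⇒0<x⁻¹ 0<2 2½≈1)
    aa≤nn : ∀ n → n * n ≈ a * a + b * b → a * a ≤ n * n
    aa≤nn n nn≈ = 0≤y-x⇒x≤y (≤-respʳ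
      (trans (solve 2 (λ a b → b :* b := (a :* a :+ b :* b) :- a :* a) refl a b) (+-congʳ (sym nn≈)))
      (0≤x*x b))
    0≤n+a : ∀ n → 0# ≤ n → n * n ≈ a * a + b * b → 0# ≤ n + a
    0≤n+a n 0≤n nn≈ = a*a≤n*n⇒0≤n+a 0≤n (aa≤nn n nn≈)
    0≤n-a : ∀ n → 0# ≤ n → n * n ≈ a * a + b * b → 0# ≤ n - a
    0≤n-a n 0≤n nn≈ = a*a≤n*n⇒0≤n+a 0≤n
      (≤-respˡ (solve 1 (λ a → a :* a := (:- a) :* (:- a)) refl a) (aa≤nn n nn≈))
    real : ∀ n p q → p * p ≈ (n + a) * ½ → q * q ≈ (n - a) * ½ → p * p - q * q ≈ a
    real n p q pp≈ qq≈ = trans (+-cong pp≈ (-‿cong qq≈))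
      (trans (solve 3 (λ n a h → (n :+ a) :* h :- (n :- a) :* h
                                 := (:1 :+ :1) :* h :* a) refl n a ½)
      (trans (*-congʳ 2½≈1) (*-identityˡ a)))
    imaginary : ∀ n p q → n * n ≈ a * a + b * b → p * p ≈ (n + a) * ½ → q * q ≈ (n - a) * ½ →
      (p * q + q * p) * (p * q + q * p) ≈ b * b
    imaginary n p q nn≈ pp≈ qq≈ = trans
      (solve 2 (λ p q → (p :* q :+ q :* p) :* (p :* q :+ q :* p)
        := (p :* p :+ p :* p) :* (q :* q :+ q :* q)) refl p q)
      (trans (*-cong (trans (+-cong pp≈ pp≈) (double (n + a))) (trans (+-cong qq≈ qq≈) (double (n - a))))
      (trans (solve 2 (λ n a → (n :+ a) :* (n :- a) := n :* n :- a :* a) refl n a)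
      (trans (+-congʳ nn≈)
      (solve 2 (λ a b → (a :* a :+ b :* b) :- a :* a := b :* b) refl a b))))
      where
      double : ∀ x → x * ½ + x * ½ ≈ x
      double x = trans (solve 2 (λ x h → x :* h :+ x :* h := (:1 :+ :1) :* h :* x) refl x ½)
        (trans (*-congʳ 2½≈1) (*-identityˡ x))
    choose : ∀ p q → p * p - q * q ≈ a → (p * q + q * p) * (p * q + q * p) ≈ b * b → ⊥
    choose p q real square with ((p * q + q * p) - b) ≟ 0#
    ... | yes d≈0 = none (p +i q , (real ,
      trans (solve 2 (λ m b → m := (m :- b) :+ b) refl (p * q + q * p) b) (trans (+-congʳ d≈0) (+-identityˡ b))))
    ... | no  d≉0 = none (p +i - q ,
      ( trans (solve 2 (λ p q → p :* p :- (:- q) :* (:- q) := p :* p :- q :* q) refl p q) real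
      , trans (solve 3 (λ p q b → p :* (:- q) :+ (:- q) :* p := b :- ((p :* q :+ q :* p) :+ b)) refl p q b)
          (trans (+-congˡ (-‿cong (*-cancelˡ-≈0 d≉0 (trans
            (solve 2 (λ m b → (m :- b) :* (m :+ b) := m :* m :- b :* b) refl (p * q + q * p) b)
            (trans (+-congʳ square) (-‿inverseʳ _))))))
          (solve 1 (λ b → b :- :0 := b) refl b)) ))

-- Descent directions for Argand's argument.

module ArgandDirection {c ℓ₁ ℓ₂} (ℝ : CompleteOrderedField c ℓ₁ ℓ₂) where
  open CompleteOrderedField ℝ hiding (zero)
  open OrderedField ℝ
  open ComplexNumbers ℝ
  open SquareRoots ℝ
  open Hurwitz ℝ using (ℂ; _+i_; re; im)
  open Exp 𝐂.semiring using (_^_; ^-assocʳ; ^-congˡ)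
  private module S = 𝐂-Solver

  parity : ∀ k → ∃[ j ] (k ≡ 2 ℕ.* j ⊎ k ≡ suc (2 ℕ.* j))
  parity zero = 0 , inj₁ ≡.refl
  parity (suc k) with parity k
  ... | j , inj₁ ≡.refl = j , inj₂ ≡.refl
  ... | j , inj₂ ≡.refl = suc j , inj₁ (≡.sym (ℕ.*-suc 2 j))

  [-z]^odd : ∀ z j → (𝐂.- z) ^ suc (2 ℕ.* j) ≃ 𝐂.- (z ^ suc (2 ℕ.* j))
  [-z]^odd z j = 𝐂.trans
    (𝐂.*-congˡ (𝐂.trans (𝐂.sym (^-assocʳ (𝐂.- z) 2 j))
      (𝐂.trans (^-congˡ j square) (^-assocʳ z 2 j))))
    (S.solve 2 (λ z w → (S.:- z) S.:* w S.:= S.:- (z S.:* w)) 𝐂.refl z (z ^ (2 ℕ.* j)))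
    where
    square : (𝐂.- z) ^ 2 ≃ z ^ 2
    square = S.solve 1 (λ z → (S.:- z) S.:* ((S.:- z) S.:* S.:1)
                              S.:= z S.:* (z S.:* S.:1)) 𝐂.refl z

  1^n≃1 : ∀ n → 𝐂.1# ^ n ≃ 𝐂.1#
  1^n≃1 zero    = 𝐂.refl
  1^n≃1 (suc n) = 𝐂.trans (𝐂.*-identityˡ _) (1^n≃1 n)

  [-1]^n≃±1 : ∀ n → (𝐂.- 𝐂.1#) ^ n ≃ 𝐂.1# ⊎ (𝐂.- 𝐂.1#) ^ n ≃ 𝐂.- 𝐂.1#
  [-1]^n≃±1 zero = inj₁ 𝐂.refl
  [-1]^n≃±1 (suc n) with [-1]^n≃±1 n
  ... | inj₁ h = inj₂ (𝐂.trans (𝐂.*-congˡ h) (𝐂.*-identityʳ _))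
  ... | inj₂ h = inj₁ (𝐂.trans (𝐂.*-congˡ h)
    (S.solve 0 ((S.:- S.:1) S.:* (S.:- S.:1) S.:= S.:1) 𝐂.refl))

  𝐢^[2j]≃[-1]^j : ∀ j → 𝐢 ^ (2 ℕ.* j) ≃ (𝐂.- 𝐂.1#) ^ j
  𝐢^[2j]≃[-1]^j j = 𝐂.trans (𝐂.sym (^-assocʳ 𝐢 2 j)) (^-congˡ j 𝐢²≃-1)
    where
    𝐢²≃-1 : 𝐢 ^ 2 ≃ 𝐂.- 𝐂.1#
    𝐢²≃-1 = 𝐂.trans (𝐂.*-congˡ (𝐂.*-identityʳ 𝐢))
      ( solve 0 (:0 :* :0 :- :1 :* :1 := :- :1) refl
      , solve 0 (:0 :* :1 :+ :1 :* :0 := :- :0) refl )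

  𝐢^odd≃±𝐢 : ∀ j → 𝐢 ^ suc (2 ℕ.* j) ≃ 𝐢 ⊎ 𝐢 ^ suc (2 ℕ.* j) ≃ 𝐂.- 𝐢
  𝐢^odd≃±𝐢 j with [-1]^n≃±1 j
  ... | inj₁ h = inj₁ (𝐂.trans (𝐂.*-congˡ (𝐂.trans (𝐢^[2j]≃[-1]^j j) h)) (𝐂.*-identityʳ 𝐢))
  ... | inj₂ h = inj₂ (𝐂.trans (𝐂.*-congˡ (𝐂.trans (𝐢^[2j]≃[-1]^j j) h))
    (S.solve 1 (λ z → z S.:* (S.:- S.:1) S.:= S.:- z) 𝐂.refl 𝐢))

  0<∥g∥²∥a∥² : ∀ {g a} → ¬ g ≃ 𝐂.0# → ¬ a ≃ 𝐂.0# → 0# < ∥ g ∥² * ∥ a ∥²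
  0<∥g∥²∥a∥² g≄0 a≄0 = 0<x*y (0<∥z∥² g≄0) (0<∥z∥² a≄0)

  -- g conj(a) has real part x and imaginary part ± y.
  ∥g∥²∥a∥²≈x²+y² : ∀ {w} → w ≃ 𝐢 ⊎ w ≃ 𝐂.- 𝐢 → ∀ g a →
    ∥ g ∥² * ∥ a ∥² ≈ ⟨ g , a ⟩ * ⟨ g , a ⟩ + ⟨ w 𝐂.* g , a ⟩ * ⟨ w 𝐂.* g , a ⟩
  ∥g∥²∥a∥²≈x²+y² (inj₁ h) g@(x +i y) a@(u +i v) = trans
    (solve 4 (λ x y u v → (x :* x :+ y :* y) :* (u :* u :+ v :* v)
      := (x :* u :+ y :* v) :* (x :* u :+ y :* v) :+
        ((:0 :* x :- :1 :* y) :* u :+ (:0 :* y :+ :1 :* x) :* v) :*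
        ((:0 :* x :- :1 :* y) :* u :+ (:0 :* y :+ :1 :* x) :* v)) refl x y u v)
    (+-congˡ (*-cong e e))
    where
    e : ⟨ 𝐢 𝐂.* g , a ⟩ ≈ _
    e = ⟨⟩-cong (𝐂.*-congʳ (𝐂.sym h)) 𝐂.refl
  ∥g∥²∥a∥²≈x²+y² (inj₂ h) g@(x +i y) a@(u +i v) = trans
    (solve 4 (λ x y u v → (x :* x :+ y :* y) :* (u :* u :+ v :* v)
      := (x :* u :+ y :* v) :* (x :* u :+ y :* v) :+
        (((:- :0) :* x :- (:- :1) :* y) :* u :+ ((:- :0) :* y :+ (:- :1) :* x) :* v) :*
        (((:- :0) :* x :- (:- :1) :* y) :* u :+ ((:- :0) :* y :+ (:- :1) :* x) :* v)) refl x y u v)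
    (+-congˡ (*-cong e e))
    where
    e : ⟨ (𝐂.- 𝐢) 𝐂.* g , a ⟩ ≈ _
    e = ⟨⟩-cong (𝐂.*-congʳ (𝐂.sym h)) 𝐂.refl

  -- If f(z₀ + w) = a + wᵏ g(z₀ + w), the dominant change tᵏ uᵏ g of f along w = t u has a negative
  -- component along a.
  Descends : ℕ → ℂ → ℂ → ℂ → Set (ℓ₁ ⊔ ℓ₂)
  Descends k g a u = 0# < - ⟨ u ^ k 𝐂.* g , a ⟩

  -- For odd k, iᵏ = ± i and (-u)ᵏ = -uᵏ. The components of g and of ± i g along a cannot both be
  -- zero, their squares adding up to |g|² |a|²; so one of 1, -1, i, -i descends.
  odd-direction : ∀ j {g a} → ¬ g ≃ 𝐂.0# → ¬ a ≃ 𝐂.0# → ∃[ u ] Descends (suc (2 ℕ.* j)) g a u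
  odd-direction j {g} {a} g≄0 a≄0 = try
    where
    k = suc (2 ℕ.* j)
    opposite : ∀ z → 0# < ⟨ z ^ k 𝐂.* g , a ⟩ → Descends k g a (𝐂.- z)
    opposite z h = 0<-resp (trans (negate (z ^ k) g a)
      (-‿cong (⟨⟩-cong (𝐂.*-congʳ (𝐂.sym ([-z]^odd z j))) 𝐂.refl))) h
      where
      negate : ∀ w g a → ⟨ w 𝐂.* g , a ⟩ ≈ - ⟨ (𝐂.- w) 𝐂.* g , a ⟩
      negate (p +i q) (x +i y) (u +i v) = solve 6 (λ p q x y u v →
        (p :* x :- q :* y) :* u :+ (p :* y :+ q :* x) :* v
        := :- ((((:- p) :* x :- (:- q) :* y) :* u) :+ ((:- p) :* y :+ (:- q) :* x) :* v)) refl p q x y u v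
    1^k≃1 : ⟨ 𝐂.1# ^ k 𝐂.* g , a ⟩ ≈ ⟨ g , a ⟩
    1^k≃1 = ⟨⟩-cong (𝐂.trans (𝐂.*-congʳ (1^n≃1 k)) (𝐂.*-identityˡ g)) 𝐂.refl
    try : ∃[ u ] Descends k g a u
    try with sign ⟨ 𝐂.1# ^ k 𝐂.* g , a ⟩
    ... | negative h = 𝐂.1# , h
    ... | positive h = 𝐂.- 𝐂.1# , opposite 𝐂.1# h
    ... | null x≈0 with sign ⟨ 𝐢 ^ k 𝐂.* g , a ⟩
    ...   | negative h = 𝐢 , h
    ...   | positive h = 𝐂.- 𝐢 , opposite 𝐢 h
    ...   | null y≈0 = ⊥-elim (proj₂ (0<∥g∥²∥a∥² g≄0 a≄0) (sym
      (trans (∥g∥²∥a∥²≈x²+y² (𝐢^odd≃±𝐢 j) g a)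
      (trans (+-cong (*-congʳ (trans (sym 1^k≃1) x≈0)) (*-congʳ y≈0))
      (trans (+-cong (zeroˡ _) (zeroˡ _)) (+-identityʳ 0#))))))

  -- For k = 2j, a square root of a direction for j is a direction for k. The bound `b` on k makes
  -- the halving structurally recursive.
  direction : ∀ b k → k ℕ.≤ b → k ≢ 0 → ∀ {g a} → ¬ g ≃ 𝐂.0# → ¬ a ≃ 𝐂.0# →
    ¬ ¬ (∃[ u ] Descends k g a u)
  direction zero    .zero z≤n k≢0 g≄0 a≄0 none = k≢0 ≡.refl
  direction (suc b) k k≤b k≢0 {g} {a} g≄0 a≄0 none with parity k
  ... | j , inj₂ ≡.refl = none (odd-direction j g≄0 a≄0)
  ... | j , inj₁ ≡.refl = direction b j (ℕ.≤-pred (ℕ.≤-trans j<2j k≤b)) j≢0 g≄0 a≄0 λ (v , h) →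
    complex-sqrt v λ (u , uu≃v) → none (u , 0<-resp
      (-‿cong (⟨⟩-cong (𝐂.*-congʳ (root u v uu≃v)) 𝐂.refl)) h)
    where
    j≢0 : j ≢ 0
    j≢0 ≡.refl = k≢0 ≡.refl
    j<2j : suc j ℕ.≤ 2 ℕ.* j
    j<2j = ℕ.m<m+n j (ℕ.≤-trans (ℕ.n≢0⇒n>0 j≢0) (ℕ.m≤m+n j 0))
    root : ∀ u v → u 𝐂.* u ≃ v → v ^ j ≃ u ^ (2 ℕ.* j)
    root u v uu≃v = 𝐂.trans
      (^-congˡ j (𝐂.trans (𝐂.sym uu≃v) (𝐂.*-congˡ (𝐂.sym (𝐂.*-identityʳ u))))) (^-assocʳ u 2 j)

-- The fundamental theorem of algebra.

module FundamentalTheorem {c ℓ₁ ℓ₂} (ℝ : CompleteOrderedField c ℓ₁ ℓ₂) where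
  open CompleteOrderedField ℝ hiding (zero)
  open OrderedField ℝ
  open ComplexNumbers ℝ
  open Compactness ℝ
  open ArgandDirection ℝ
  open Hurwitz ℝ using (ℂ; _+i_; re; im)
  open Exp 𝐂.semiring using (_^_; ^-assocʳ; ^-congˡ)
  private module S = 𝐂-Solver

  -- Divides by z - z₀ as long as z₀ is a root; the degree falls each time, and the constant 1 has
  -- no root. So k is the order of vanishing at z₀.
  split-off : ∀ n (q : Vec ℂ n) z₀ → ∃[ k ] ∃[ m ] ∃[ g ]
    (¬ eval {m} g z₀ ≃ 𝐂.0#) × (∀ z → eval q z ≃ (z 𝐂.- z₀) ^ k 𝐂.* eval g z)
  split-off zero [] z₀ = 0 , 0 , [] , (λ h → 1≉0 (re≈ h)) , λ z → 𝐂.sym (𝐂.*-identityˡ 𝐂.1#)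
  split-off (suc n) q z₀ with eval q z₀ ≟ᶜ0
  ... | no  q≄0 = 0 , suc n , q , q≄0 , λ z → 𝐂.sym (𝐂.*-identityˡ _)
  ... | yes q≃0 with split-off n (quotient q z₀) z₀
  ...   | k , m , g , g≄0 , eq = suc k , m , g , g≄0 , λ z → 𝐂.trans (eval-quotient q z₀ z)
    (𝐂.trans (𝐂.+-cong q≃0 (𝐂.*-congˡ (eq z)))
    (𝐂.trans (𝐂.+-identityˡ _) (𝐂.sym (𝐂.*-assoc _ _ _))))

  -- τ is t to the power k + 1, which is at most t because t ≤ 1.
  power : ∀ {t} → 0# < t → t ≤ 1# → ∀ k →
    ∃[ τ ] 0# < τ × τ ≤ t × (∀ u → (ι t 𝐂.* u) ^ suc k ≃ ι τ 𝐂.* u ^ suc k)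
  power {t} 0<t t≤1 zero = t , 0<t , ≤-refl , λ u →
    S.solve 2 (λ t u → (t S.:* u) S.:* S.:1 S.:= t S.:* (u S.:* S.:1)) 𝐂.refl (ι t) u
  power {t} 0<t t≤1 (suc k) with power 0<t t≤1 k
  ... | τ , 0<τ , τ≤t , eq = t * τ , 0<x*y 0<t 0<τ ,
    0≤y-x⇒x≤y (≤-respʳ (solve 2 (λ t τ → t :* (:1 :- τ) := t :- t :* τ) refl t τ)
      (*-nonNegative (proj₁ 0<t) (x≤y⇒0≤y-x (≤-trans τ≤t t≤1)))) ,
    λ u → 𝐂.trans (𝐂.*-congˡ (eq u))
      (𝐂.trans (S.solve 4 (λ t u s w → (t S.:* u) S.:* (s S.:* w) S.:= (t S.:* s) S.:* (u S.:* w)) 𝐂.refl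
        (ι t) u (ι τ) (u ^ suc k))
      (𝐂.*-congʳ
        ( solve 2 (λ t τ → t :* τ :- :0 :* :0 := t :* τ) refl t τ
        , solve 2 (λ t τ → t :* :0 :+ :0 :* τ := :0) refl t τ)))

  -- The decrease is τ(-2⟨h, a⟩ - τ|h|²). Replacing the inner τ by a larger t leaves a nonnegative
  -- remainder and a main term that is free of the power τ.
  ∥a∥²-∥a+τh∥² : ∀ τ t a h → ∥ a ∥² - ∥ a 𝐂.+ ι τ 𝐂.* h ∥²
    ≈ τ * (- (⟨ h , a ⟩ + ⟨ h , a ⟩ + t * ∥ h ∥²) + (t - τ) * ∥ h ∥²)
  ∥a∥²-∥a+τh∥² τ t (a +i b) (x +i y) = solve 6 (λ τ t a b x y →
    (a :* a :+ b :* b) :- ((a :+ (τ :* x :- :0 :* y)) :* (a :+ (τ :* x :- :0 :* y)) :+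
                           (b :+ (τ :* y :+ :0 :* x)) :* (b :+ (τ :* y :+ :0 :* x)))
    := τ :* ((:- ((x :* a :+ y :* b) :+ (x :* a :+ y :* b) :+ t :* (x :* x :+ y :* y)))
         :+ (t :- τ) :* (x :* x :+ y :* y)))
    refl τ t a b x y

  module _ {n} (p : Vec ℂ (suc n)) where

    private
      module Along (z₀ : ℂ) (k m : ℕ) (g : Vec ℂ m) (u : ℂ)
        (eq : ∀ z → eval (quotient p z₀) z ≃ (z 𝐂.- z₀) ^ k 𝐂.* eval g z)
        (descends : Descends (suc k) (eval g z₀) (eval p z₀) u) where

        a : ℂ
        a = eval p z₀

        -- The ray from z₀ in the direction u, its parameter being a real part so that the Lipschitz
        -- calculus on ℂ applies.
        point : ℂ → ℂ
        point w = z₀ 𝐂.+ ι (re w) 𝐂.* u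

        h : ℂ → ℂ
        h w = u ^ suc k 𝐂.* eval g (point w)

        -- The main term of the decrease at t = `re w`. At 0 it is positive because u descends,
        -- hence also for small t.
        G : ℂ → Carrier
        G w = - (⟨ h w , a ⟩ + ⟨ h w , a ⟩ + re w * ∥ h w ∥²)

        lip-h : LipschitzAtᶜ {𝐂.0#} h
        lip-h = lipᶜ-* (lipᶜ-const (u ^ suc k)) (lipᶜ-eval g
          (lipᶜ-+ (lipᶜ-const z₀) (lipᶜ-* (lip-re , lip-const 0#) (lipᶜ-const u))))

        lip-G : LipschitzAt 𝐂.0# G
        lip-G = lip-neg (lip-+ (lip-+ ⟨h,a⟩ ⟨h,a⟩) (lip-* lip-re (lip-⟨⟩ lip-h lip-h)))
          where ⟨h,a⟩ = lip-⟨⟩ lip-h (lipᶜ-const a)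

        h0≃ : h 𝐂.0# ≃ u ^ suc k 𝐂.* eval g z₀
        h0≃ = 𝐂.*-congˡ (eval-cong g (S.solve 2 (λ z u → z S.:+ S.:0 S.:* u S.:= z) 𝐂.refl z₀ u))

        0<G0 : 0# < G 𝐂.0#
        0<G0 = 0<-resp (trans (solve 2 (λ x n → :- x :+ :- x := :- (x :+ x :+ :0 :* n)) refl
            ⟨ u ^ suc k 𝐂.* eval g z₀ , a ⟩ ∥ h 𝐂.0# ∥²)
            (-‿cong (+-congʳ (+-cong e e))))
          (0<x+y descends (proj₁ descends))
          where e = ⟨⟩-cong {w = a} (𝐂.sym h0≃) 𝐂.refl

        value : ∀ δ τ → (ι δ 𝐂.* u) ^ suc k ≃ ι τ 𝐂.* u ^ suc k →
          eval p (point (ι δ)) ≃ a 𝐂.+ ι τ 𝐂.* h (ι δ)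
        value δ τ pow = 𝐂.trans (eval-quotient p z₀ z) (𝐂.+-congˡ (𝐂.trans (𝐂.*-congˡ (eq z))
          (𝐂.trans (𝐂.sym (𝐂.*-assoc (z 𝐂.- z₀) ((z 𝐂.- z₀) ^ k) (eval g z)))
          (𝐂.trans (𝐂.*-congʳ (𝐂.trans (^-congˡ (suc k) z-z₀) pow))
          (𝐂.*-assoc (ι τ) (u ^ suc k) (eval g z))))))
          where
          z = point (ι δ)
          z-z₀ : z 𝐂.- z₀ ≃ ι δ 𝐂.* u
          z-z₀ = S.solve 2 (λ z w → (z S.:+ w) S.:- z S.:= w) 𝐂.refl z₀ (ι δ 𝐂.* u)

        lower : ∃[ w ] Below p w z₀
        lower =
          let (δ , 0<δ , δ≤1 , persists) = stays-positive lip-G 0<G0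
              (τ , 0<τ , τ≤δ , pow) = power 0<δ δ≤1 k
          in point (ι δ) , below δ τ 0<δ 0<τ τ≤δ persists (pow u)
          where
          below : ∀ δ τ → 0# < δ → 0# < τ → τ ≤ δ → (∀ w → Near δ 𝐂.0# w → 0# < G w) →
            (ι δ 𝐂.* u) ^ suc k ≃ ι τ 𝐂.* u ^ suc k → Below p (point (ι δ)) z₀
          below δ τ 0<δ 0<τ τ≤δ persists pow = 0<-resp
            (trans (sym (∥a∥²-∥a+τh∥² τ δ a (h (ι δ))))
              (+-congˡ (-‿cong (⟨⟩-cong (𝐂.sym (value δ τ pow)) (𝐂.sym (value δ τ pow))))))
            (0<x*y 0<τ (0<x+y
              (persists (ι δ)
                ( (≤-respʳ (solve 1 (λ δ → δ :+ δ := δ :+ (δ :- :0)) refl δ) (0≤x+y (proj₁ 0<δ) (proj₁ 0<δ))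
                  , ≤-reflexive (solve 1 (λ δ → :0 := δ :- (δ :- :0)) refl δ))
                , (≤-respʳ (solve 1 (λ δ → δ := δ :+ (:0 :- :0)) refl δ) (proj₁ 0<δ)
                  , ≤-respʳ (solve 1 (λ δ → δ := δ :- (:0 :- :0)) refl δ) (proj₁ 0<δ))))
              (*-nonNegative (x≤y⇒0≤y-x τ≤δ) (0≤∥∥² (h (ι δ))))))

    descent : ∀ z₀ → ¬ eval p z₀ ≃ 𝐂.0# → ¬ ¬ (∃[ w ] Below p w z₀)
    -- This gives p(z) = p(z₀) + (z - z₀)^(k+1) g(z) with g(z₀) ≠ 0; the extra factor comes from the
    -- quotient, whence the exponent `suc k`.
    descent z₀ pz₀≄0 none with split-off n (quotient p z₀) z₀
    ... | k , m , g , g≄0 , eq = direction (suc k) (suc k) ℕ.≤-refl (λ ()) g≄0 pz₀≄0 λ (u , descends) →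
      none (Along.lower z₀ k m g u eq descends)

    has-root : ¬ ¬ (∃[ z ] eval p z ≃ 𝐂.0#)
    has-root none = no-descent p λ z → descent z λ pz≃0 → none (z , pz≃0)

-- Two real-part inequalities for polynomials with roots in the left half-plane.

module RootsInLeftHalfPlane {c ℓ₁ ℓ₂} (ℝ : CompleteOrderedField c ℓ₁ ℓ₂) where
  open CompleteOrderedField ℝ hiding (zero)
  open OrderedField ℝ
  open ComplexNumbers ℝ
  open FundamentalTheorem ℝ
  open Hurwitz ℝ using (ℂ; _+i_; re; im)
  open Mult semiring using () renaming (_×_ to _·_)
  private module S = 𝐂-Solver

  LeftHalfPlane : ℂ → Set ℓ₂
  LeftHalfPlane r = 0# ≤ - re r

  -- Zeros of the quotient are zeros of p, so the quotient again has none on the right and the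
  -- induction continues.
  factorization : ∀ n (p : Vec ℂ n) → (∀ z → 0# < re z → ¬ eval p z ≃ 𝐂.0#) →
    ¬ ¬ (∃[ rs ] All LeftHalfPlane {n} rs ×
      (∀ z → eval p z ≃ evalRoots rs z × evalDerivative p z ≃ evalRootsDerivative rs z))
  factorization zero    [] p≄0 none = none ([] , [] , λ z → 𝐂.refl , 𝐂.refl)
  factorization (suc n) p  p≄0 none = has-root p λ (r , pr≃0) →
    let p≃ : ∀ z → eval p z ≃ (z 𝐂.- r) 𝐂.* eval (quotient p r) z
        p≃ z = 𝐂.trans (eval-quotient p r z) (𝐂.trans (𝐂.+-congʳ pr≃0) (𝐂.+-identityˡ _))
    in factorization n (quotient p r)
      (λ z 0<z q≃0 → p≄0 z 0<z (𝐂.trans (p≃ z) (𝐂.trans (𝐂.*-congˡ q≃0) (𝐂.zeroʳ (z 𝐂.- r)))))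
      λ (rs , left , eq) → none (r ∷ rs , left-root r pr≃0 ∷ left , λ z →
          𝐂.trans (p≃ z) (𝐂.*-congˡ (proj₁ (eq z)))
        , 𝐂.trans (evalDerivative-quotient p r z) (𝐂.+-cong (proj₁ (eq z)) (𝐂.*-congˡ (proj₂ (eq z)))))
    where
    left-root : ∀ r → eval p r ≃ 𝐂.0# → LeftHalfPlane r
    left-root r pr≃0 with pos⊎nonpos (re r)
    ... | inj₁ 0<r  = ⊥-elim (p≄0 r 0<r pr≃0)
    ... | inj₂ 0≤-r = 0≤-r

  ⟨⟩-+ˡ : ∀ a b w → ⟨ a 𝐂.+ b , w ⟩ ≈ ⟨ a , w ⟩ + ⟨ b , w ⟩
  ⟨⟩-+ˡ (a +i a′) (b +i b′) (x +i y) = solve 6 (λ a a′ b b′ x y →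
    (a :+ b) :* x :+ (a′ :+ b′) :* y := (a :* x :+ a′ :* y) :+ (b :* x :+ b′ :* y)) refl a a′ b b′ x y

  ⟨⟩-scaleˡ : ∀ s a w → ⟨ ι s 𝐂.* a , w ⟩ ≈ s * ⟨ a , w ⟩
  ⟨⟩-scaleˡ s (a +i b) (x +i y) = solve 5 (λ s a b x y →
    (s :* a :- :0 :* b) :* x :+ (s :* b :+ :0 :* a) :* y := s :* (a :* x :+ b :* y))
    refl s a b x y

  ⟨⟩-comm : ∀ z w → ⟨ z , w ⟩ ≈ ⟨ w , z ⟩
  ⟨⟩-comm z w = +-cong (*-comm _ _) (*-comm _ _)

  ⟨⟩-*ʳ : ∀ a w q → ⟨ a 𝐂.* q , w 𝐂.* q ⟩ ≈ ⟨ a , w ⟩ * ∥ q ∥²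
  ⟨⟩-*ʳ a w q = trans (⟨⟩-cong (𝐂.*-comm a q) (𝐂.*-comm w q)) (trans (⟨⟩-*ˡ q a w) (*-comm _ _))

  ⟨w*q,q⟩ : ∀ w q → ⟨ w 𝐂.* q , q ⟩ ≈ re w * ∥ q ∥²
  ⟨w*q,q⟩ (u +i v) (x +i y) = solve 4 (λ u v x y →
    (u :* x :- v :* y) :* x :+ (u :* y :+ v :* x) :* y := u :* (x :* x :+ y :* y)) refl u v x y

  0<re[z-r] : ∀ {z r} → 0# < re z → LeftHalfPlane r → 0# < re (z 𝐂.- r)
  0<re[z-r] 0<z 0≤-r = 0<x+y 0<z 0≤-r

  0<∥evalRoots∥² : ∀ {n} {rs : Vec ℂ n} → All LeftHalfPlane rs → ∀ {z} → 0# < re z →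
    0# < ∥ evalRoots rs z ∥²
  0<∥evalRoots∥² []           0<z = 0<re⇒0<∥∥² 0<1
  0<∥evalRoots∥² {rs = r ∷ rs} (l ∷ left) {z} 0<z = 0<-resp (sym (∥∥²-* (z 𝐂.- r) (evalRoots rs z)))
    (0<x*y (0<re⇒0<∥∥² {z 𝐂.- r} (0<re[z-r] {z} {r} 0<z l)) (0<∥evalRoots∥² left 0<z))

  mutual
    0≤⟨P′,P⟩ : ∀ {n} {rs : Vec ℂ n} → All LeftHalfPlane rs → ∀ {z} → 0# < re z →
      0# ≤ ⟨ evalRootsDerivative rs z , evalRoots rs z ⟩
    0≤⟨P′,P⟩ [] 0<z = ≤-reflexive (solve 0
      (:0 := :0 :* :1 :+ :0 :* :0) refl)
    0≤⟨P′,P⟩ left@(_ ∷ _) 0<z = proj₁ (0<⟨P′,P⟩ left 0<z)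

    -- This is Re(P′/P) = Σ Re 1/(z - r) multiplied by |P|², one root at a time: for P = w q with w
    -- = z - r, ⟨P′, P⟩ = Re w |q|² + |w|² ⟨q′, q⟩.
    0<⟨P′,P⟩ : ∀ {n} {rs : Vec ℂ (suc n)} → All LeftHalfPlane rs → ∀ {z} → 0# < re z →
      0# < ⟨ evalRootsDerivative rs z , evalRoots rs z ⟩
    0<⟨P′,P⟩ {rs = r ∷ rs} (l ∷ left) {z} 0<z = 0<-resp
      (sym (trans (⟨⟩-+ˡ q (w 𝐂.* q′) (w 𝐂.* q))
        (+-cong (trans (⟨⟩-comm q (w 𝐂.* q)) (⟨w*q,q⟩ w q)) (⟨⟩-*ˡ w q′ q))))
      (0<x+y (0<x*y (0<re[z-r] {z} {r} 0<z l) (0<∥evalRoots∥² left 0<z))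
             (*-nonNegative (0≤∥∥² w) (0≤⟨P′,P⟩ left 0<z)))
      where
      w = z 𝐂.- r
      q = evalRoots rs z
      q′ = evalRootsDerivative rs z

  # : ℕ → Carrier
  # n = n · 1#

  0≤# : ∀ n → 0# ≤ # n
  0≤# zero    = ≤-refl
  0≤# (suc n) = 0≤x+y (proj₁ 0<1) (0≤# n)

  -- y ↦ yⁿ P(1/y) has derivative yⁿ⁻² (n z P(z) − z² P′(z)) at y = 1/z.
  reversed′ : ∀ {n} → Vec ℂ n → ℂ → ℂ
  reversed′ {n} rs z = ι (# n) 𝐂.* z 𝐂.* evalRoots rs z 𝐂.- z 𝐂.* (z 𝐂.* evalRootsDerivative rs z)

  -- Euler's relation, which singles out P = xⁿ: the equality case, whose reversed polynomial is
  -- constant.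
  Homogeneous : ∀ {n} → Vec ℂ n → Set (c ⊔ ℓ₁)
  Homogeneous {n} rs = ∀ z → z 𝐂.* evalRootsDerivative rs z ≃ ι (# n) 𝐂.* evalRoots rs z

  homogeneous-[] : Homogeneous []
  homogeneous-[] z = 𝐂.trans (𝐂.zeroʳ z) (𝐂.sym (𝐂.zeroˡ 𝐂.1#))

  homogeneous⇒reversed′≃0 : ∀ {n} (rs : Vec ℂ n) → Homogeneous rs → ∀ z → reversed′ rs z ≃ 𝐂.0#
  homogeneous⇒reversed′≃0 {n} rs hom z = 𝐂.trans (𝐂.+-congˡ (𝐂.-‿cong (𝐂.*-congˡ (hom z))))
    (S.solve 3 (λ n z p → n S.:* z S.:* p S.:- z S.:* (n S.:* p) S.:= S.:0) 𝐂.refl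
      (ι (# n)) z (evalRoots rs z))

  ι[1+x] : ∀ x → ι (1# + x) ≃ 𝐂.1# 𝐂.+ ι x
  ι[1+x] x = refl , sym (+-identityʳ 0#)

  -- Reversing x - r gives 1 - r y, with derivative -r; the product rule thus adds -r z q to the old
  -- term multiplied by z - r. The new pairing |r|² Re z - |z|² Re r is a sum of nonnegative terms
  -- if Re r ≤ 0 < Re z.
  reversed′-∷ : ∀ {n} r (rs : Vec ℂ n) z →
    ⟨ reversed′ (r ∷ rs) z , evalRoots (r ∷ rs) z ⟩
    ≈ ∥ z 𝐂.- r ∥² * ⟨ reversed′ rs z , evalRoots rs z ⟩
      + (∥ r ∥² * re z + ∥ z ∥² * - re r) * ∥ evalRoots rs z ∥²
  reversed′-∷ {n} r rs z = trans (⟨⟩-cong expand 𝐂.refl)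
    (trans (⟨⟩-+ˡ (w 𝐂.* reversed′ rs z) ((𝐂.- (r 𝐂.* z)) 𝐂.* q) (w 𝐂.* q))
    (+-cong (⟨⟩-*ˡ w (reversed′ rs z) q)
      (trans (⟨⟩-*ʳ (𝐂.- (r 𝐂.* z)) w q) (*-congʳ (⟨-rz,z-r⟩ r z)))))
    where
    w = z 𝐂.- r
    q = evalRoots rs z
    q′ = evalRootsDerivative rs z
    expand : reversed′ (r ∷ rs) z ≃ w 𝐂.* reversed′ rs z 𝐂.+ (𝐂.- (r 𝐂.* z)) 𝐂.* q
    expand = 𝐂.trans (𝐂.+-congʳ (𝐂.*-congʳ (𝐂.*-congʳ (ι[1+x] (# n)))))
      (S.solve 5 (λ n z r q q′ →
        (S.:1 S.:+ n) S.:* z S.:* ((z S.:- r) S.:* q) S.:- z S.:* (z S.:* (q S.:+ (z S.:- r) S.:* q′))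
        S.:= (z S.:- r) S.:* (n S.:* z S.:* q S.:- z S.:* (z S.:* q′)) S.:+ (S.:- (r S.:* z)) S.:* q)
        𝐂.refl (ι (# n)) z r q q′)
    ⟨-rz,z-r⟩ : ∀ r z → ⟨ 𝐂.- (r 𝐂.* z) , z 𝐂.- r ⟩ ≈ ∥ r ∥² * re z + ∥ z ∥² * - re r
    ⟨-rz,z-r⟩ (a +i b) (x +i y) = solve 4 (λ a b x y →
      (:- (a :* x :- b :* y)) :* (x :- a) :+ (:- (a :* y :+ b :* x)) :* (y :- b)
      := (a :* a :+ b :* b) :* x :+ (x :* x :+ y :* y) :* (:- a)) refl a b x y

  0≤⟨reversed′,P⟩ : ∀ {n} {rs : Vec ℂ n} → All LeftHalfPlane rs → ∀ {z} → 0# < re z →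
    0# ≤ ⟨ reversed′ rs z , evalRoots rs z ⟩
  0≤⟨reversed′,P⟩ [] {z} 0<z = ≤-reflexive (sym (trans
    (⟨⟩-cong (homogeneous⇒reversed′≃0 [] homogeneous-[] z) (𝐂.refl {𝐂.1#}))
    (solve 0 (:0 :* :1 :+ :0 :* :0 := :0) refl)))
  0≤⟨reversed′,P⟩ {rs = r ∷ rs} (l ∷ left) {z} 0<z = ≤-respʳ (sym (reversed′-∷ r rs z))
    (0≤x+y (*-nonNegative (0≤∥∥² (z 𝐂.- r)) (0≤⟨reversed′,P⟩ left 0<z))
      (*-nonNegative (0≤x+y (*-nonNegative (0≤∥∥² r) (proj₁ 0<z)) (*-nonNegative (0≤∥∥² z) l))
        (0≤∥∥² (evalRoots rs z))))

  -- A root r ≠ 0 contributes at least |r|² Re z |q|² > 0; if every root is 0, then P = xⁿ.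
  reversed′-dichotomy : ∀ {n} {rs : Vec ℂ n} → All LeftHalfPlane rs → ∀ {z} → 0# < re z →
    0# < ⟨ reversed′ rs z , evalRoots rs z ⟩ ⊎ Homogeneous rs
  reversed′-dichotomy [] 0<z = inj₂ homogeneous-[]
  reversed′-dichotomy {suc n} {r ∷ rs} (l ∷ left) {z} 0<z with sign ∥ r ∥²
  ... | positive 0<r = inj₁ (0<-resp (sym (reversed′-∷ r rs z))
    (0<y+x (0<x*y (0<x+y (0<x*y 0<r 0<z) (*-nonNegative (0≤∥∥² z) l)) (0<∥evalRoots∥² left 0<z))
           (*-nonNegative (0≤∥∥² (z 𝐂.- r)) (0≤⟨reversed′,P⟩ left 0<z))))
  ... | negative r<0 = ⊥-elim (0<x⇒0≰-x r<0 (≤-respʳ (solve 1 (λ x → x := :- (:- x)) refl ∥ r ∥²) (0≤∥∥² r)))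
  ... | null r≈0 with reversed′-dichotomy left 0<z
  ...   | inj₁ h = inj₁ (0<-resp (sym (reversed′-∷ r rs z))
    (0<x+y (0<x*y (0<re⇒0<∥∥² {z 𝐂.- r} (0<re[z-r] {z} {r} 0<z l)) h)
      (*-nonNegative (0≤x+y (*-nonNegative (0≤∥∥² r) (proj₁ 0<z)) (*-nonNegative (0≤∥∥² z) l))
        (0≤∥∥² (evalRoots rs z)))))
  ...   | inj₂ hom = inj₂ λ x → homogeneous x (∥z∥²≈0⇒z≃0 r≈0)
    where
    homogeneous : ∀ x → r ≃ 𝐂.0# →
      x 𝐂.* evalRootsDerivative (r ∷ rs) x ≃ ι (# (suc n)) 𝐂.* evalRoots (r ∷ rs) x
    homogeneous x r≃0 =
      𝐂.trans (𝐂.*-congˡ (𝐂.+-congˡ (𝐂.*-congʳ x-r≃x)))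
      (𝐂.trans (𝐂.*-congˡ (𝐂.+-congˡ (hom x)))
      (𝐂.trans (S.solve 3 (λ x n q → x S.:* (q S.:+ n S.:* q) S.:= (S.:1 S.:+ n) S.:* (x S.:* q)) 𝐂.refl
        x (ι (# n)) (evalRoots rs x))
      (𝐂.*-cong (𝐂.sym (ι[1+x] (# n))) (𝐂.*-congʳ (𝐂.sym x-r≃x)))))
      where
      x-r≃x : x 𝐂.- r ≃ x
      x-r≃x = 𝐂.trans (𝐂.+-congˡ (𝐂.-‿cong r≃0)) (S.solve 1 (λ x → x S.:- S.:0 S.:= x) 𝐂.refl x)

-- One step of the recurrence at a point of the right half-plane.

module Recurrence {c ℓ₁ ℓ₂} (ℝ : CompleteOrderedField c ℓ₁ ℓ₂) where
  open CompleteOrderedField ℝ hiding (zero)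
  open OrderedField ℝ
  open ComplexNumbers ℝ
  open RootsInLeftHalfPlane ℝ
  open Hurwitz ℝ using (ℂ; _+i_; re; im)
  open Mult semiring using () renaming (_×_ to _·_; ×-assoc-* to ·-assoc-*; ×-congʳ to ·-congʳ)
  private module S = 𝐂-Solver

  module _ (α β γ μ φ : Carrier) where

    -- An operator on functions, so that it applies to evaluated coefficient lists and to products
    -- over roots alike.
    step : (T T′ : ℂ → ℂ) → ℂ → ℂ
    step T T′ z = (ι γ 𝐂.+ z 𝐂.* (ι β 𝐂.+ z 𝐂.* ι α)) 𝐂.* T z
             𝐂.+ z 𝐂.* (ι φ 𝐂.+ z 𝐂.* (z 𝐂.* ι μ)) 𝐂.* T′ z

    module _ {n} {rs : Vec ℂ n} (left : All LeftHalfPlane rs)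
      (0≤β : 0# ≤ β) (0≤γ : 0# ≤ γ) (0≤φ : 0# ≤ φ)
      (0≤-nμ : 0# ≤ - (n · μ)) (-nμ≤α : - (n · μ) ≤ α) where

      private
        P P′ : ℂ → ℂ
        P = evalRoots rs
        P′ = evalRootsDerivative rs

        σ : Carrier
        σ = α + # n * μ

        nμ≈#n*μ : n · μ ≈ # n * μ
        nμ≈#n*μ = trans (sym (·-congʳ n (*-identityˡ μ))) (sym (·-assoc-* n 1# μ))

        0≤σ : 0# ≤ σ
        0≤σ = ≤-respʳ (trans (solve 2 (λ a m → a :- (:- m) := a :+ m) refl α (n · μ)) (+-congˡ nμ≈#n*μ))
          (x≤y⇒0≤y-x -nμ≤α)

        X : ℂ → ℂ
        X z = ι σ 𝐂.* (z 𝐂.* P z) 𝐂.+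
             (ι β 𝐂.* P z 𝐂.+ (ι φ 𝐂.* P′ z 𝐂.+ ι (- μ) 𝐂.* reversed′ rs z))

        ισ : ι α ≃ ι σ 𝐂.+ ι (# n) 𝐂.* ι (- μ)
        ισ = solve 3 (λ a n m → a := (a :+ n :* m) :+ (n :* (:- m) :- :0 :* :0)) refl α (# n) μ
           , solve 2 (λ n m → :0 := :0 :+ (n :* :0 :+ :0 :* (:- m))) refl (# n) μ

        ιμ : ι μ ≃ 𝐂.- ι (- μ)
        ιμ = solve 1 (λ m → m := :- (:- m)) refl μ , solve 0 (:0 := :- :0) refl

        step≃ : ∀ z → step P P′ z ≃ z 𝐂.* X z 𝐂.+ ι γ 𝐂.* P z
        -- `α` becomes σ + n(-μ) and `μ` becomes -(-μ), which makes -μ an atom for the solver.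
        step≃ z = 𝐂.trans
          (𝐂.+-cong (𝐂.*-congʳ (𝐂.+-congˡ (𝐂.*-congˡ (𝐂.+-congˡ (𝐂.*-congˡ ισ)))))
                    (𝐂.*-congʳ (𝐂.*-congˡ (𝐂.+-congˡ (𝐂.*-congˡ (𝐂.*-congˡ ιμ))))))
          (S.solve 9 (λ σ n m β γ φ z p p′ →
            (γ S.:+ z S.:* (β S.:+ z S.:* (σ S.:+ n S.:* m))) S.:* p
            S.:+ z S.:* (φ S.:+ z S.:* (z S.:* (S.:- m))) S.:* p′
            S.:= z S.:* (σ S.:* (z S.:* p)
                   S.:+ (β S.:* p S.:+ (φ S.:* p′ S.:+ m S.:* (n S.:* z S.:* p S.:- z S.:* (z S.:* p′))))) S.:+ γ S.:* p)
            𝐂.refl (ι σ) (ι (# n)) (ι (- μ)) (ι β) (ι γ) (ι φ) z (P z) (P′ z))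

        A B N : ℂ → Carrier
        A z = ⟨ P′ z , P z ⟩
        B z = ⟨ reversed′ rs z , P z ⟩
        N z = ∥ P z ∥²

        ⟨X,P⟩ : ∀ z → ⟨ X z , P z ⟩ ≈ σ * (re z * N z) + (β * N z + (φ * A z + - μ * B z))
        ⟨X,P⟩ z = trans (⟨⟩-+ˡ (ι σ 𝐂.* (z 𝐂.* P z)) _ (P z)) (+-cong
            (trans (⟨⟩-scaleˡ σ (z 𝐂.* P z) (P z)) (*-congˡ (⟨w*q,q⟩ z (P z))))
          (trans (⟨⟩-+ˡ (ι β 𝐂.* P z) _ (P z)) (+-cong (⟨⟩-scaleˡ β (P z) (P z))
          (trans (⟨⟩-+ˡ (ι φ 𝐂.* P′ z) _ (P z)) (+-cong (⟨⟩-scaleˡ φ (P′ z) (P z))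
            (⟨⟩-scaleˡ (- μ) (reversed′ rs z) (P z)))))))

        ⟨step,zP⟩ : ∀ z → ⟨ step P P′ z , z 𝐂.* P z ⟩ ≈
          ∥ z ∥² * (σ * (re z * N z) + (β * N z + (φ * A z + - μ * B z))) + γ * (re z * N z)
        ⟨step,zP⟩ z = trans (⟨⟩-cong (step≃ z) 𝐂.refl)
          (trans (⟨⟩-+ˡ (z 𝐂.* X z) (ι γ 𝐂.* P z) (z 𝐂.* P z)) (+-cong
            (trans (⟨⟩-*ˡ z (X z) (P z)) (*-congˡ (⟨X,P⟩ z)))
            (trans (⟨⟩-scaleˡ γ (P z) (z 𝐂.* P z))
              (*-congˡ (trans (⟨⟩-comm (P z) (z 𝐂.* P z)) (⟨w*q,q⟩ z (P z)))))))

        -- From 0 ≤ -nμ follows -μ ≥ 0 only when n > 0; for n = 0 the sign of μ is unknown, but the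
        -- reversed term is zero.
        0≤-μB : ∀ {n} {rs : Vec ℂ n} → All LeftHalfPlane rs → 0# ≤ - (# n * μ) → ∀ {z} → 0# < re z →
          0# ≤ - μ * ⟨ reversed′ rs z , evalRoots rs z ⟩
        0≤-μB [] _ {z} 0<z = ≤-reflexive (sym (trans
          (*-congˡ (trans (⟨⟩-cong (homogeneous⇒reversed′≃0 [] homogeneous-[] z) (𝐂.refl {𝐂.1#}))
            (solve 0 (:0 :* :1 :+ :0 :* :0 := :0) refl)))
          (zeroʳ (- μ))))
        0≤-μB {suc n} left@(_ ∷ _) 0≤-#nμ 0<z = *-nonNegative
          (*-cancelˡ-0≤ (0<x+y 0<1 (0≤# n))
            (≤-respʳ (solve 2 (λ n m → :- (n :* m) := n :* (:- m)) refl (# (suc n)) μ) 0≤-#nμ))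
          (0≤⟨reversed′,P⟩ left 0<z)

        -- Either P is constant and P′ = 0, or ⟨P′, P⟩ > 0 forces φ = 0.
        φP′≃0 : ∀ {n} {rs : Vec ℂ n} → All LeftHalfPlane rs → ∀ {z} → 0# < re z →
          φ * ⟨ evalRootsDerivative rs z , evalRoots rs z ⟩ ≈ 0# →
          ∀ x → ι φ 𝐂.* evalRootsDerivative rs x ≃ 𝐂.0#
        φP′≃0 [] _ _ x = 𝐂.zeroʳ (ι φ)
        φP′≃0 {rs = rs} left@(_ ∷ _) 0<z φA≈0 x = 𝐂.trans
          (𝐂.*-congʳ {evalRootsDerivative rs x} (φ≈0 , refl)) (𝐂.zeroˡ _)
          where
          φ≈0 : φ ≈ 0#
          φ≈0 = *-cancelˡ-≈0 (λ A≈0 → proj₂ (0<⟨P′,P⟩ left 0<z) (sym A≈0)) (trans (*-comm _ φ) φA≈0)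

        -- A vanishing sum of nonnegative terms vanishes termwise. As Re z and |P|² are positive, σ,
        -- β and γ vanish themselves; `A` and `B` may be zero and stay as factors.
        vanishing-terms : ∀ {z} → 0# < re z → step P P′ z ≃ 𝐂.0# →
          σ ≈ 0# × β ≈ 0# × γ ≈ 0# × φ * A z ≈ 0# × - μ * B z ≈ 0#
        vanishing-terms {z} 0<z s≃0 =
            *-cancelˡ-≈0 rN≉0 (trans (*-comm _ σ) (x+y≈0⇒x≈0 0≤t₁ 0≤t₂₃₄ t₁₂₃₄≈0))
          , *-cancelˡ-≈0 N≉0 (trans (*-comm _ β) (x+y≈0⇒x≈0 0≤t₂ 0≤t₃₄ t₂₃₄≈0))
          , *-cancelˡ-≈0 rN≉0 (trans (*-comm _ γ) (x+y≈0⇒y≈0 0≤Zt 0≤t₅ total≈0))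
          , x+y≈0⇒x≈0 0≤t₃ 0≤t₄ t₃₄≈0
          , x+y≈0⇒y≈0 0≤t₃ 0≤t₄ t₃₄≈0
          where
          0<N = 0<∥evalRoots∥² left 0<z
          0<rN = 0<x*y 0<z 0<N
          0<Z = 0<re⇒0<∥∥² {z} 0<z
          N≉0 : N z ≉ 0#
          N≉0 h = proj₂ 0<N (sym h)
          rN≉0 : re z * N z ≉ 0#
          rN≉0 h = proj₂ 0<rN (sym h)
          0≤t₁ = *-nonNegative 0≤σ (proj₁ 0<rN)
          0≤t₂ = *-nonNegative 0≤β (proj₁ 0<N)
          0≤t₃ = *-nonNegative 0≤φ (0≤⟨P′,P⟩ left 0<z)
          0≤t₄ = 0≤-μB left (≤-respʳ (-‿cong nμ≈#n*μ) 0≤-nμ) 0<z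
          0≤t₅ = *-nonNegative 0≤γ (proj₁ 0<rN)
          0≤t₃₄ = 0≤x+y 0≤t₃ 0≤t₄
          0≤t₂₃₄ = 0≤x+y 0≤t₂ 0≤t₃₄
          0≤Zt = *-nonNegative (proj₁ 0<Z) (0≤x+y 0≤t₁ 0≤t₂₃₄)
          total≈0 : ∥ z ∥² * (σ * (re z * N z) + (β * N z + (φ * A z + - μ * B z))) + γ * (re z * N z) ≈ 0#
          total≈0 = trans (sym (⟨step,zP⟩ z)) (trans (⟨⟩-cong s≃0 (𝐂.refl {z 𝐂.* P z}))
            (trans (+-cong (zeroˡ _) (zeroˡ _)) (+-identityʳ 0#)))
          t₁₂₃₄≈0 = *-cancelˡ-≈0 (λ h → proj₂ 0<Z (sym h)) (x+y≈0⇒x≈0 0≤Zt 0≤t₅ total≈0)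
          t₂₃₄≈0 = x+y≈0⇒y≈0 0≤t₁ 0≤t₂₃₄ t₁₂₃₄≈0
          t₃₄≈0 = x+y≈0⇒y≈0 0≤t₂ 0≤t₃₄ t₂₃₄≈0

      -- What vanishes at z does so for reasons independent of z: σ, β and γ are zero, φ P′ is zero
      -- everywhere, and either μ = 0 or P = xⁿ, whose reversed term is identically zero.
      step≃0⇒step≡0 : ∀ {z} → 0# < re z → step P P′ z ≃ 𝐂.0# → ∀ x → step P P′ x ≃ 𝐂.0#
      step≃0⇒step≡0 {z} 0<z s≃0 x =
        let (σ≈0 , β≈0 , γ≈0 , φA≈0 , -μB≈0) = vanishing-terms 0<z s≃0
        in all-vanish σ≈0 β≈0 γ≈0 (φP′≃0 left 0<z φA≈0 x)
             (-μreversed′≃0 -μB≈0 (reversed′-dichotomy left 0<z))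
        where
        kill : ∀ {s} → s ≈ 0# → ∀ w → ι s 𝐂.* w ≃ 𝐂.0#
        kill s≈0 w = 𝐂.trans (𝐂.*-congʳ {w} (s≈0 , refl)) (𝐂.zeroˡ w)
        -μreversed′≃0 : - μ * B z ≈ 0# → 0# < B z ⊎ Homogeneous rs → ι (- μ) 𝐂.* reversed′ rs x ≃ 𝐂.0#
        -μreversed′≃0 -μB≈0 (inj₁ 0<B) = kill
          (*-cancelˡ-≈0 (λ B≈0 → proj₂ 0<B (sym B≈0)) (trans (*-comm (B z) (- μ)) -μB≈0)) (reversed′ rs x)
        -μreversed′≃0 _ (inj₂ hom) =
          𝐂.trans (𝐂.*-congˡ (homogeneous⇒reversed′≃0 rs hom x)) (𝐂.zeroʳ (ι (- μ)))
        all-vanish : σ ≈ 0# → β ≈ 0# → γ ≈ 0# → ι φ 𝐂.* P′ x ≃ 𝐂.0# →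
          ι (- μ) 𝐂.* reversed′ rs x ≃ 𝐂.0# → step P P′ x ≃ 𝐂.0#
        all-vanish σ≈0 β≈0 γ≈0 φP′≃0 -μR≃0 = 𝐂.trans (step≃ x) (𝐂.trans
          (𝐂.+-cong
            (𝐂.*-congˡ (𝐂.+-cong (kill σ≈0 (x 𝐂.* P x)) (𝐂.+-cong (kill β≈0 (P x)) (𝐂.+-cong φP′≃0 -μR≃0))))
            (kill γ≈0 (P x)))
          (S.solve 1 (λ x → x S.:* (S.:0 S.:+ (S.:0 S.:+ (S.:0 S.:+ S.:0))) S.:+ S.:0
            S.:= S.:0) 𝐂.refl x))

-- From coefficient lists to products over roots, and the induction on n.

module RealPolynomials {c ℓ₁ ℓ₂} (ℝ : CompleteOrderedField c ℓ₁ ℓ₂) where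
  open CompleteOrderedField ℝ hiding (zero)
  open OrderedField ℝ
  open ComplexNumbers ℝ
  open RootsInLeftHalfPlane ℝ
  open Recurrence ℝ
  open Hurwitz ℝ using (ℂ; _+i_; re; im; HurwitzStable; toℂ[x]; module ℂ[x])
  open Mult semiring using () renaming (_×_ to _·_; ×-assoc-* to ·-assoc-*; ×-congʳ to ·-congʳ)
  open Coefficients using (module R[x]; derivativeAt; eval-≋; normalize)
  private
    module S = 𝐂-Solver
    module ℝ[x] = Polynomial rawRing

  evaluate : ℝ[x].Poly → ℂ → ℂ
  evaluate p = R[x].eval (map ι p)

  ι-+ : ∀ a b → ι (a + b) ≃ ι a 𝐂.+ ι b
  ι-+ a b = refl , sym (+-identityʳ 0#)

  ι-* : ∀ a b → ι (a * b) ≃ ι a 𝐂.* ι b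
  ι-* a b = solve 2 (λ a b → a :* b := a :* b :- :0 :* :0) refl a b
          , solve 2 (λ a b → :0 := a :* :0 :+ :0 :* b) refl a b

  coeff-map : ∀ p k → R[x].coeff (map ι p) k ≡ ι (ℝ[x].coeff p k)
  coeff-map []      k       = ≡.refl
  coeff-map (a ∷ p) zero    = ≡.refl
  coeff-map (a ∷ p) (suc k) = coeff-map p k

  evaluate-≋ : ∀ p q → p ℝ[x].≋ q → ∀ z → evaluate p z ≃ evaluate q z
  evaluate-≋ p q p≋q = eval-≋ (map ι p) (map ι q) λ k → 𝐂.trans (𝐂.reflexive (coeff-map p k))
    (𝐂.trans (p≋q k , refl) (𝐂.reflexive (≡.sym (coeff-map q k))))

  evaluate-⊕ : ∀ p q z → evaluate (p ℝ[x].⊕ q) z ≃ evaluate p z 𝐂.+ evaluate q z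
  evaluate-⊕ []      q       z = 𝐂.sym (𝐂.+-identityˡ _)
  evaluate-⊕ (a ∷ p) []      z = 𝐂.sym (𝐂.+-identityʳ _)
  evaluate-⊕ (a ∷ p) (b ∷ q) z = 𝐂.trans
    (𝐂.+-cong (ι-+ a b) (𝐂.*-congˡ (evaluate-⊕ p q z)))
    (S.solve 5 (λ a b z p q → (a S.:+ b) S.:+ z S.:* (p S.:+ q) S.:= (a S.:+ z S.:* p) S.:+ (b S.:+ z S.:* q))
      𝐂.refl (ι a) (ι b) z (evaluate p z) (evaluate q z))

  evaluate-scale : ∀ a p z → evaluate (map (a *_) p) z ≃ ι a 𝐂.* evaluate p z
  evaluate-scale a []      z = 𝐂.sym (𝐂.zeroʳ (ι a))
  evaluate-scale a (b ∷ p) z = 𝐂.trans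
    (𝐂.+-cong (ι-* a b) (𝐂.*-congˡ (evaluate-scale a p z)))
    (S.solve 4 (λ a b z p → a S.:* b S.:+ z S.:* (a S.:* p) S.:= a S.:* (b S.:+ z S.:* p))
      𝐂.refl (ι a) (ι b) z (evaluate p z))

  evaluate-⊗ : ∀ p q z → evaluate (p ℝ[x].⊗ q) z ≃ evaluate p z 𝐂.* evaluate q z
  evaluate-⊗ []      q z = 𝐂.sym (𝐂.zeroˡ (evaluate q z))
  evaluate-⊗ (a ∷ p) q z = 𝐂.trans (evaluate-⊕ (map (a *_) q) (0# ∷ (p ℝ[x].⊗ q)) z) (𝐂.trans
    (𝐂.+-cong (evaluate-scale a q z) (𝐂.+-congˡ (𝐂.*-congˡ (evaluate-⊗ p q z))))
    (S.solve 4 (λ a z p q → a S.:* q S.:+ (S.:0 S.:+ z S.:* (p S.:* q)) S.:= (a S.:+ z S.:* p) S.:* q)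
      𝐂.refl (ι a) z (evaluate p z) (evaluate q z)))

  evaluateDerivative : ℝ[x].Poly → ℂ → ℂ
  evaluateDerivative p = derivativeAt (map ι p)

  -- For k > 0 this is the derivative of xᵏ p divided by xᵏ⁻¹; a general k is needed because the
  -- recursion raises it.
  evaluate-scaleFrom : ∀ k p z → evaluate (ℝ[x].scaleFrom k p) z
    ≃ ι (# k) 𝐂.* evaluate p z 𝐂.+ z 𝐂.* evaluateDerivative p z
  evaluate-scaleFrom k []      z =
    S.solve 2 (λ k z → S.:0 S.:= k S.:* S.:0 S.:+ z S.:* S.:0) 𝐂.refl (ι (# k)) z
  evaluate-scaleFrom k (a ∷ p) z = 𝐂.trans
    (𝐂.+-cong (𝐂.trans (k·a≈#k*a , refl) (ι-* (# k) a))
      (𝐂.*-congˡ (𝐂.trans (evaluate-scaleFrom (suc k) p z) (𝐂.+-congʳ (𝐂.*-congʳ (ι[1+x] (# k)))))))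
    (S.solve 5 (λ k a z p d →
      k S.:* a S.:+ z S.:* ((S.:1 S.:+ k) S.:* p S.:+ z S.:* d)
      S.:= k S.:* (a S.:+ z S.:* p) S.:+ z S.:* (p S.:+ z S.:* d))
      𝐂.refl (ι (# k)) (ι a) z (evaluate p z) (evaluateDerivative p z))
    where
    k·a≈#k*a : k · a ≈ # k * a
    k·a≈#k*a = trans (sym (·-congʳ k (*-identityˡ a))) (sym (·-assoc-* k 1# a))

  evaluate-derivative : ∀ p z → evaluate (ℝ[x].derivative p) z ≃ evaluateDerivative p z
  evaluate-derivative []      z = 𝐂.refl
  evaluate-derivative (a ∷ p) z = 𝐂.trans (evaluate-scaleFrom 1 p z)
    (𝐂.+-congʳ (𝐂.trans (𝐂.*-congʳ (+-identityʳ 1# , refl)) (𝐂.*-identityˡ (evaluate p z))))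

  ℂ-*-≄0 : ∀ {z w} → ¬ z ≃ 𝐂.0# → ¬ w ≃ 𝐂.0# → ¬ z 𝐂.* w ≃ 𝐂.0#
  ℂ-*-≄0 {z} {w} z≄0 w≄0 = 0<∥z∥²⇒z≄0
    (0<-resp (sym (∥∥²-* z w)) (0<x*y (0<∥z∥² z≄0) (0<∥z∥² w≄0)))

  module _ p m (deg : ℝ[x].HasDegree p m) where

    leading : Carrier
    leading = ℝ[x].coeff p m

    ι-leading≄0 : ¬ ι leading ≃ 𝐂.0#
    ι-leading≄0 h = proj₁ deg (re≈ h)

    monic-part : ∃[ q ] ∀ z → evaluate p z ≃ ι leading 𝐂.* eval {m} q z
                            × evaluateDerivative p z ≃ ι leading 𝐂.* evalDerivative q z
    monic-part =
      let (u , cu≈1) = inverse leading (proj₁ deg)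
          (q , eq) = normalize (map ι p) m {ι u}
            (𝐂.trans (𝐂.*-congʳ (𝐂.reflexive (coeff-map p m)))
              (𝐂.trans (𝐂.sym (ι-* leading u)) (cu≈1 , refl)))
            (λ k m<k → 𝐂.trans (𝐂.reflexive (coeff-map p k)) (proj₂ deg k m<k , refl))
      in q , λ z → 𝐂.trans (proj₁ (eq z)) (𝐂.*-congʳ (𝐂.reflexive (coeff-map p m)))
                 , 𝐂.trans (proj₂ (eq z)) (𝐂.*-congʳ (𝐂.reflexive (coeff-map p m)))

    -- Far out the monic part has modulus at least 1.
    somewhere-nonzero : ¬ (∀ z → evaluate p z ≃ 𝐂.0#)
    somewhere-nonzero p≡0 =
      let (q , eq) = monic-part
          (R , 0≤R , q≥1) = eventually≥1 q
          -- Far enough out, since (1 + R)² ≥ R.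
          x = ι (1# + R)
          R≤∥x∥² : R ≤ ∥ x ∥²
          R≤∥x∥² = 0≤y-x⇒x≤y (≤-respʳ
            (solve 1 (λ r → :1 :+ (r :+ r :* r) := ((:1 :+ r) :* (:1 :+ r) :+ :0 :* :0) :- r) refl R)
            (0≤x+y (proj₁ 0<1) (0≤x+y 0≤R (0≤x*x R))))
          0<∥q∥² = 0<-resp (solve 1 (λ n → :1 :+ (n :- :1) := n) refl ∥ eval q x ∥²)
            (0<x+y 0<1 (x≤y⇒0≤y-x (q≥1 x R≤∥x∥²)))
      in ℂ-*-≄0 ι-leading≄0 (0<∥z∥²⇒z≄0 0<∥q∥²) (𝐂.trans (𝐂.sym (proj₁ (eq x))) (p≡0 x))

  Nonvanishing : ℝ[x].Poly → Set _
  Nonvanishing p = ∀ z → 0# < re z → ¬ evaluate p z ≃ 𝐂.0#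

  module _ (α β γ μ φ : Carrier) (p q : ℝ[x].Poly)
    (recurrence : q ℝ[x].≋ (γ ∷ β ∷ α ∷ []) ℝ[x].⊗ p ℝ[x].⊕ (0# ∷ φ ∷ 0# ∷ μ ∷ []) ℝ[x].⊗ ℝ[x].derivative p)
    where

    evaluate-step : ∀ z → evaluate q z ≃ step α β γ μ φ (evaluate p) (evaluateDerivative p) z
    evaluate-step z = 𝐂.trans
      (evaluate-≋ q ((γ ∷ β ∷ α ∷ []) ℝ[x].⊗ p ℝ[x].⊕ (0# ∷ φ ∷ 0# ∷ μ ∷ []) ℝ[x].⊗ ℝ[x].derivative p)
      recurrence z) (𝐂.trans
      (evaluate-⊕ ((γ ∷ β ∷ α ∷ []) ℝ[x].⊗ p) ((0# ∷ φ ∷ 0# ∷ μ ∷ []) ℝ[x].⊗ ℝ[x].derivative p) z) (𝐂.trans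
      (𝐂.+-cong (evaluate-⊗ (γ ∷ β ∷ α ∷ []) p z)
        (𝐂.trans (evaluate-⊗ (0# ∷ φ ∷ 0# ∷ μ ∷ []) (ℝ[x].derivative p) z)
          (𝐂.*-congˡ (evaluate-derivative p z))))
      (S.solve 8 (λ α β γ μ φ z t t′ →
        (γ S.:+ z S.:* (β S.:+ z S.:* (α S.:+ z S.:* S.:0))) S.:* t S.:+
        (S.:0 S.:+ z S.:* (φ S.:+ z S.:* (S.:0 S.:+ z S.:* (μ S.:+ z S.:* S.:0)))) S.:* t′
        S.:= (γ S.:+ z S.:* (β S.:+ z S.:* α)) S.:* t S.:+ z S.:* (φ S.:+ z S.:* (z S.:* μ)) S.:* t′)
        𝐂.refl (ι α) (ι β) (ι γ) (ι μ) (ι φ) z (evaluate p z) (evaluateDerivative p z))))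

    module _ m m′ (deg : ℝ[x].HasDegree p m) (deg′ : ℝ[x].HasDegree q m′)
      (0≤β : 0# ≤ β) (0≤γ : 0# ≤ γ) (0≤φ : 0# ≤ φ)
      (0≤-mμ : 0# ≤ - (m · μ)) (-mμ≤α : - (m · μ) ≤ α) where

      private
        lead : ℂ
        lead = ι (leading p m deg)
        monic : Vec ℂ m
        monic = proj₁ (monic-part p m deg)

        step-factors : ∀ (rs : Vec ℂ m) →
          (∀ z → eval monic z ≃ evalRoots rs z × evalDerivative monic z ≃ evalRootsDerivative rs z) →
          ∀ z → evaluate q z ≃ lead 𝐂.* step α β γ μ φ (evalRoots rs) (evalRootsDerivative rs) z
        step-factors rs eq z = 𝐂.trans (evaluate-step z) (𝐂.trans
          (𝐂.+-cong
            (𝐂.*-congˡ (𝐂.trans (proj₁ (proj₂ (monic-part p m deg) z)) (𝐂.*-congˡ (proj₁ (eq z)))))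
            (𝐂.*-congˡ (𝐂.trans (proj₂ (proj₂ (monic-part p m deg) z)) (𝐂.*-congˡ (proj₂ (eq z))))))
          (S.solve 5 (λ a b l p d →
            a S.:* (l S.:* p) S.:+ b S.:* (l S.:* d) S.:= l S.:* (a S.:* p S.:+ b S.:* d))
            𝐂.refl (ι γ 𝐂.+ z 𝐂.* (ι β 𝐂.+ z 𝐂.* ι α)) (z 𝐂.* (ι φ 𝐂.+ z 𝐂.* (z 𝐂.* ι μ))) lead
            (evalRoots rs z) (evalRootsDerivative rs z)))

      -- Being a negation, the goal may use the doubly negated factorization of the monic part; a
      -- zero at z then spreads to every x, against the degree of `q`.
      nonvanishing-step : Nonvanishing p → Nonvanishing q
      nonvanishing-step p≄0 z 0<z qz≃0 = factorization m monic
        (λ w 0<w h → p≄0 w 0<w (𝐂.trans (proj₁ (proj₂ (monic-part p m deg) w))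
          (𝐂.trans (𝐂.*-congˡ h) (𝐂.zeroʳ lead))))
        λ (rs , left , eq) → somewhere-nonzero q m′ deg′ λ x →
          𝐂.trans (step-factors rs eq x) (𝐂.trans
            (𝐂.*-congˡ (step≃0⇒step≡0 α β γ μ φ left 0≤β 0≤γ 0≤φ 0≤-mμ -mμ≤α 0<z (step-zero rs eq) x))
            (𝐂.zeroʳ lead))
        where
        lead*step≃0 : ∀ rs →
          (∀ z → eval monic z ≃ evalRoots rs z × evalDerivative monic z ≃ evalRootsDerivative rs z) →
          lead 𝐂.* step α β γ μ φ (evalRoots rs) (evalRootsDerivative rs) z ≃ 𝐂.0#
        lead*step≃0 rs eq = 𝐂.trans (𝐂.sym (step-factors rs eq z)) qz≃0
        step-zero : ∀ rs →
          (∀ z → eval monic z ≃ evalRoots rs z × evalDerivative monic z ≃ evalRootsDerivative rs z) →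
          step α β γ μ φ (evalRoots rs) (evalRootsDerivative rs) z ≃ 𝐂.0#
        step-zero rs eq = ∥z∥²≈0⇒z≃0 (*-cancelˡ-≈0
          (λ h → proj₂ (0<∥z∥² (ι-leading≄0 p m deg)) (sym h))
          (trans (sym (∥∥²-* lead (step α β γ μ φ (evalRoots rs) (evalRootsDerivative rs) z))) (trans
            (⟨⟩-cong (lead*step≃0 rs eq) (lead*step≃0 rs eq))
            (trans (+-cong (zeroˡ 0#) (zeroˡ 0#)) (+-identityʳ 0#)))))

  re-coeff-toℂ[x] : ∀ p k → re (ℂ[x].coeff (toℂ[x] p) k) ≡ ℝ[x].coeff p k
  re-coeff-toℂ[x] []      k       = ≡.refl
  re-coeff-toℂ[x] (a ∷ p) zero    = ≡.refl
  re-coeff-toℂ[x] (a ∷ p) (suc k) = re-coeff-toℂ[x] p k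

  stable⇒nonvanishing : ∀ p m → ℝ[x].HasDegree p m → HurwitzStable (toℂ[x] p) → Nonvanishing p
  stable⇒nonvanishing p m deg (inj₁ p≋[]) = ⊥-elim (proj₁ deg
    (trans (reflexive (≡.sym (re-coeff-toℂ[x] p m))) (proj₁ (p≋[] m))))
  -- Both evaluations agree by computation; only the packaging of equality, pair or record, differs.
  stable⇒nonvanishing p m deg (inj₂ p≉0) z 0<z (re≈0 , im≈0) = p≉0 z 0<z (re≈0 , im≈0)

  nonvanishing⇒stable : ∀ p → Nonvanishing p → HurwitzStable (toℂ[x] p)
  nonvanishing⇒stable p p≄0 = inj₂ λ z 0<z (re≈0 , im≈0) → p≄0 z 0<z (re≈0 , im≈0)

  module _ (n₀ : ℕ) (T : ℕ → ℝ[x].Poly) (α β γ μ φ : ℕ → Carrier)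
    (recurrence : ∀ n → n₀ ≤ℕ n →
      T (suc n) ℝ[x].≋ (γ n ∷ β n ∷ α n ∷ []) ℝ[x].⊗ T n
                 ℝ[x].⊕ (0# ∷ φ n ∷ 0# ∷ μ n ∷ []) ℝ[x].⊗ ℝ[x].derivative (T n))
    (0≤βγφ : ∀ n → n₀ ≤ℕ n → 0# ≤ β n × 0# ≤ γ n × 0# ≤ φ n)
    (stable : HurwitzStable (toℂ[x] (T n₀)))
    (m : ℕ → ℕ)
    (condition : ∀ n → n₀ ≤ℕ n →
      ℝ[x].HasDegree (T n) (m n) × - (m n · μ n) ≤ α n × 0# ≤ - (m n · μ n)) where

    -- Nonvanishing, unlike stability, carries no alternative for the zero polynomial; the degree at
    -- `suc n` ensures that a step does not produce it.
    all-nonvanishing : ∀ {n} → n₀ ℕ.≤′ n → Nonvanishing (T n)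
    all-nonvanishing ℕ.≤′-refl = stable⇒nonvanishing (T n₀) (m n₀) (proj₁ (condition n₀ ℕ.≤-refl)) stable
    all-nonvanishing {suc n} (ℕ.≤′-step n₀≤′n) =
      let n₀≤n = ℕ.≤′⇒≤ n₀≤′n
          (deg , -mμ≤α , 0≤-mμ) = condition n n₀≤n
          (deg′ , _) = condition (suc n) (ℕ.m≤n⇒m≤1+n n₀≤n)
          (0≤β , 0≤γ , 0≤φ) = 0≤βγφ n n₀≤n
      in nonvanishing-step (α n) (β n) (γ n) (μ n) (φ n) (T n) (T (suc n)) (recurrence n n₀≤n)
           (m n) (m (suc n)) deg deg′ 0≤β 0≤γ 0≤φ 0≤-mμ -mμ≤α (all-nonvanishing n₀≤′n)

    all-stable : ∀ {n} → n₀ ℕ.≤′ n → HurwitzStable (toℂ[x] (T n))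
    all-stable {n} n₀≤′n = nonvanishing⇒stable (T n) (all-nonvanishing n₀≤′n)

theorem2p15 : ∀ {c ℓ₁ ℓ₂} (ℝ : CompleteOrderedField c ℓ₁ ℓ₂) →
    let open CompleteOrderedField ℝ
        open Hurwitz ℝ
        open ℝ[x]
    in
    (n₀ : ℕ) (T : ℕ → Poly) (α β γ μ φ : ℕ → Carrier) →
    (∀ n → n₀ ≤ℕ n →
      T (suc n) ≋ (γ n ∷ β n ∷ α n ∷ []) ⊗ T n
                  ⊕ (0# ∷ φ n ∷ 0# ∷ μ n ∷ []) ⊗ derivative (T n)) →
    (∀ n → n₀ ≤ℕ n → 0# ≤ β n × 0# ≤ γ n × 0# ≤ φ n) →
    HurwitzStable (toℂ[x] (T n₀)) →
    (∀ n → n₀ ≤ℕ n →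
      HasDegree (T n) n × α n ≈ - (n · μ n) × 0# ≤ - (n · μ n))
    ⊎ (Σ[ m ∈ (ℕ → ℕ) ] (∀ n → n₀ ≤ℕ n →
        HasDegree (T n) (m n) × m n ≢ n × - (m n · μ n) ≤ α n × 0# ≤ - (m n · μ n))) →
    ∀ n → n₀ ≤ℕ n → HurwitzStable (toℂ[x] (T n))
theorem2p15 ℝ n₀ T α β γ μ φ recurrence 0≤βγφ stable (inj₁ h) n n₀≤n =
  -- The first case is the instance m n = n, its equation weakened to -nμ ≤ α.
  all-stable n₀ T α β γ μ φ recurrence 0≤βγφ stable (λ n → n)
    (λ n n₀≤n → let (deg , α≈-nμ , 0≤-nμ) = h n n₀≤n in deg , ≤-reflexive (sym α≈-nμ) , 0≤-nμ)
    (ℕ.≤⇒≤′ n₀≤n)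
  where
  open CompleteOrderedField ℝ using (sym)
  open OrderedField ℝ using (≤-reflexive)
  open RealPolynomials ℝ
theorem2p15 ℝ n₀ T α β γ μ φ recurrence 0≤βγφ stable (inj₂ (m , h)) n n₀≤n =
  all-stable n₀ T α β γ μ φ recurrence 0≤βγφ stable m
    (λ n n₀≤n → let (deg , _ , -mμ≤α , 0≤-mμ) = h n n₀≤n in deg , -mμ≤α , 0≤-mμ)
    (ℕ.≤⇒≤′ n₀≤n)
  where open RealPolynomials ℝ
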